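{- Let $N>2$ be even and let $q$ be a power of $2$. Then $$t_2(N,q)\le t_2^{S^+}(2,q)\left(q^{\frac{N-2}{2}}+q^{\frac{N-4}{2}}+\dots+q+1\right).$$
   Context: A cap in $PG(N,q)$ is a set of points no three collinear; it is complete if not contained in a larger cap; an arc is a cap in $PG(2,q)$. $t_2(N,q)$ denotes the smallest size of a complete cap in $PG(N,q)$. A point is in normalized form if its first nonzero homogeneous coordinate equals $1$. For a complete arc $K$ in $PG(2,q)$ and $Q\notin K$ in normalized form, for every secant $l$ of $K$ through $Q$ write $Q=c_1^{(l)}P_1+c_2^{(l)}P_2$ with $P_1,P_2$ the points of $l\cap K$ in normalized form; $Q$ is a sum-point for $K$ if $c_1^{(l)}=c_2^{(l)}$ for all such secants $l$. If $K$ has exactly one sum-point, $p(K)$ denotes the number of secants of $K$ through that sum-point. $t_2^{S^+}(2,q)$ denotes the size of the smallest complete $k$-arc $K$ in $PG(2,q)$ with exactly one sum-point and with $(k-2)p(K)<q-1$. -}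

module Defs where

open import Level using (0ℓ)
open import Data.Nat using (ℕ; zero; suc)
open import Data.Empty using (⊥)
open import Data.Sum using (_⊎_)
open import Data.Product using (_×_; _,_; ∃; ∃-syntax; Σ)
open import Data.List using (List; []; _∷_; map; _++_; filter; length)
open import Data.List.Membership.Propositional using (_∈_; _∉_)
open import Data.List.Relation.Unary.Any using (any?)
open import Data.List.Relation.Unary.All using (All)
open import Data.List.Relation.Unary.Unique.Propositional using (Unique)
open import Data.Vec using (Vec; []; _∷_; zipWith; replicate)
import Data.Vec.Properties as VP
open import Relation.Nullary using (¬_; Dec; yes; no)
open import Relation.Binary using (DecidableEquality)
open import Relation.Binary.PropositionalEquality using (_≡_; _≢_)
open import Algebra.Structures using (IsCommutativeRing)

record FiniteField : Set₁ where
  field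
    Carrier  : Set
    _+_ _*_  : Carrier → Carrier → Carrier
    -_       : Carrier → Carrier
    0# 1#    : Carrier
    isCommutativeRing : IsCommutativeRing _≡_ _+_ _*_ -_ 0# 1#
    0≢1      : 0# ≢ 1#
    inverse  : ∀ x → x ≢ 0# → ∃[ y ] (x * y ≡ 1#)
    _≟_      : DecidableEquality Carrier
    elements : List Carrier
    complete : ∀ x → x ∈ elements
    distinct : Unique elements

  order : ℕ
  order = length elements

module Geometry (F : FiniteField) where
  open FiniteField F

  -- homogeneous coordinate vectors of PG(N,q) live in F^(N+1)
  Vector : ℕ → Set
  Vector N = Vec Carrier (suc N)

  Normalized : ∀ {n} → Vec Carrier n → Set
  Normalized []       = ⊥
  Normalized (x ∷ v)  = (x ≡ 1#) ⊎ ((x ≡ 0#) × Normalized v)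

  _·_ : ∀ {n} → Carrier → Vec Carrier n → Vec Carrier n
  c · v = Data.Vec.map (c *_) v

  _⊕_ : ∀ {n} → Vec Carrier n → Vec Carrier n → Vec Carrier n
  _⊕_ = zipWith _+_

  zeroV : ∀ {n} → Vec Carrier n
  zeroV = replicate _ 0#

  Collinear : ∀ {N} → Vector N → Vector N → Vector N → Set
  Collinear P Q R = ∃[ a ] ∃[ b ] ∃[ c ]
    (¬ (a ≡ 0# × b ≡ 0# × c ≡ 0#) × (((a · P) ⊕ (b · Q)) ⊕ (c · R)) ≡ zeroV)

  Cap : ∀ {N} → List (Vector N) → Set
  Cap K = Unique K × All Normalized K ×
    (∀ {P Q R} → P ∈ K → Q ∈ K → R ∈ K → P ≢ Q → P ≢ R → Q ≢ R → ¬ Collinear P Q R)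

  CompleteCap : ∀ {N} → List (Vector N) → Set
  CompleteCap K = Cap K × (∀ P → Normalized P → P ∉ K → ¬ Cap (P ∷ K))

  OnSecant : ∀ {N} → Vector N → Vector N → Vector N → Set
  OnSecant Q P₁ P₂ = ∃[ c₁ ] ∃[ c₂ ] (Q ≡ (c₁ · P₁) ⊕ (c₂ · P₂))

  onSecant? : ∀ {N} (Q P₁ P₂ : Vector N) → Dec (OnSecant Q P₁ P₂)
  onSecant? Q P₁ P₂ with any? (λ c₁ → any? (λ c₂ → VP.≡-dec _≟_ Q ((c₁ · P₁) ⊕ (c₂ · P₂))) elements) elements
  ... | yes p = yes (helper p)
    where
    open import Data.List.Relation.Unary.Any using (Any; here; there)
    open import Data.List.Membership.Propositional using (find)
    open import Data.Product using (proj₁; proj₂)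
    helper : Any (λ c₁ → Any (λ c₂ → Q ≡ (c₁ · P₁) ⊕ (c₂ · P₂)) elements) elements → OnSecant Q P₁ P₂
    helper a with find a
    ... | c₁ , _ , b with find b
    ...   | c₂ , _ , e = c₁ , c₂ , e
  ... | no ¬p = no (λ { (c₁ , c₂ , e) → ¬p (lose (complete c₁) (lose (complete c₂) e)) })
    where open import Data.List.Membership.Propositional using (lose)

  SumPoint : List (Vector 2) → Vector 2 → Set
  SumPoint K Q = Normalized Q × Q ∉ K ×
    (∀ {P₁ P₂} → P₁ ∈ K → P₂ ∈ K → P₁ ≢ P₂ →
      ∀ c₁ c₂ → Q ≡ (c₁ · P₁) ⊕ (c₂ · P₂) → c₁ ≡ c₂)

  UniqueSumPoint : List (Vector 2) → Vector 2 → Set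
  UniqueSumPoint K Q = SumPoint K Q × (∀ Q' → SumPoint K Q' → Q' ≡ Q)

  pairs : ∀ {A : Set} → List A → List (A × A)
  pairs []       = []
  pairs (x ∷ xs) = map (x ,_) xs ++ pairs xs

  secantCount : List (Vector 2) → Vector 2 → ℕ
  secantCount K Q = length (filter (λ { (P₁ , P₂) → onSecant? Q P₁ P₂ }) (pairs K))

geomSum : ℕ → ℕ → ℕ
geomSum q zero    = 1
geomSum q (suc m) = q Data.Nat.^ suc m Data.Nat.+ geomSum q m

{-# OPTIONS --safe #-}
module Submission where

-- Over a field of even order q, P ++ enc x with enc x = (x₁ , x₁² , … , xⱼ , xⱼ²) and P ∈ K is a cap.
-- If c₁ ≠ c₂ are nonzero, then c₁ enc x + c₂ enc y takes every value, because squaring is bijective;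
-- hence this cap covers every point whose first three coordinates are not proportional to the sum-point Q,
-- that is, every point outside the subspace spanned by Q and the last 2j coordinates.  That subspace has
-- projective dimension 2j and is filled with the cap built one level below, which only has to avoid the secants
-- of {P ++ enc x}.  In coordinates (u ; aᵢ , bᵢ) these meet the subspace in points with κ bᵢ = aᵢ² for
-- all i, where κ ≠ 0 and either u = 0 or κ = c u for some coefficient c of a secant Q = c P₁ + c P₂ of K.
-- This propagates through all levels once K and Q avoid it in the plane, and there it is achieved by a linear
-- change of coordinates: put two points of K at (0 : 1 : 0) and (0 : 0 : 1), Q at (1 : β : 0), and rescale the
-- last coordinate; (k − 2) p(K) < q − 1 leaves an admissible scale.

open import Defs
open import Data.Nat as ℕ using (ℕ; zero; suc)
import Data.Nat.Properties as ℕ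
open import Data.Unit using (⊤; tt)
open import Data.Sum using (_⊎_; inj₁; inj₂)
open import Data.Product using (_×_; _,_; ∃-syntax; proj₁; proj₂)
open import Data.Bool using (Bool; true; false)
import Data.Bool.Properties as Bool
open import Data.Maybe using (Maybe; just; nothing)
open import Data.List as List using (List; []; _∷_; foldr; length; map; filter; deduplicate; cartesianProductWith)
open import Data.List.Properties using (length-map; length-++; filter-notAll; filter-≐; length-deduplicate)
open import Data.List.Membership.Propositional using (_∈_; _∉_; find; lose)
open import Data.List.Membership.Propositional.Properties
open import Data.List.Membership.Propositional.Properties.WithK using (unique∧set⇒bag)
open import Data.List.Relation.Binary.BagAndSetEquality using (∼bag⇒↭)
open import Data.List.Relation.Binary.Permutation.Propositional using (_↭_; ↭⇒↭ₛ)
open import Data.List.Relation.Binary.Permutation.Setoid.Properties using (foldr-commMonoid)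
open import Data.List.Relation.Unary.All as All using ([]; _∷_)
open import Data.List.Relation.Unary.Any as Any using (here; there; any?)
open import Data.List.Relation.Unary.AllPairs using ([]; _∷_)
open import Data.List.Relation.Unary.Unique.Propositional using (Unique)
import Data.List.Relation.Unary.Unique.Propositional.Properties as Unique
open import Data.List.Relation.Unary.Unique.DecPropositional.Properties using (deduplicate-!)
open import Data.Vec using (Vec; []; _∷_; _++_)
import Data.Vec.Properties as Vec
open import Relation.Nullary using (¬_; Dec; yes; no; contradiction)
open import Relation.Nullary.Decidable using (¬?; _×-dec_; decidable-stable)
open import Relation.Binary using (DecidableEquality)
open import Relation.Binary.PropositionalEquality
open import Algebra.Bundles using (CommutativeRing)
open import Algebra.Solver.Ring.AlmostCommutativeRing using (AlmostCommutativeRing; fromCommutativeSemiring; _-Raw-AlmostCommutative⟶_)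
import Algebra.Properties.Ring as RingProperties
import Algebra.Properties.Semiring.Mult as Mult
import Algebra.Solver.Ring as RingSolver
open import Function using (mk⇔)

-- The points over Q dictate the construction. All secants of K through Q have equal coefficients
-- `c`, `c`, and `c · enc x ⊕ c · enc y` depends only on s = x + y because squaring is additive: it
-- consists of pairs (c s, c s²), only q^j of the q^(2j) values. So the part over Q cannot be
-- covered from the product set, and a second cap is placed there. The same rigidity makes the
-- obstruction explicit: one equation κ b = a² per pair, with a common κ. Violating a single one of
-- them suffices, and the pair used always consists of the last two plane coordinates of a point of
-- K or of a nonzero multiple of Q; hence a condition in the plane controls all levels. When u = 0
-- the value κ is an arbitrary nonzero scalar. The two points moved to (0 : 1 : 0) and (0 : 0 : 1)
-- violate κ b = a² for every such κ. They span the line u = 0, so every other point of K has u ≠ 0,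
-- and for it only the values κ = c u remain, at most p(K) of them.

module _ {A : Set} where

  unique-⊆⇒length≤ : ∀ {xs ys : List A} → Unique xs → (∀ {x} → x ∈ xs → x ∈ ys) → length xs ℕ.≤ length ys
  unique-⊆⇒length≤ {[]} _ _ = ℕ.z≤n
  unique-⊆⇒length≤ {x ∷ xs} (x∉xs ∷ u) xs⊆ys with ∈-∃++ (xs⊆ys (here refl))
  ... | as , bs , refl = subst (suc (length xs) ℕ.≤_) length-split (ℕ.s≤s (unique-⊆⇒length≤ u xs⊆as++bs))
    where
    length-split : suc (length (as List.++ bs)) ≡ length (as List.++ x ∷ bs)
    length-split rewrite length-++ as {bs} | length-++ as {x ∷ bs} = sym (ℕ.+-suc (length as) (length bs))

    xs⊆as++bs : ∀ {y} → y ∈ xs → y ∈ as List.++ bs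
    xs⊆as++bs y∈xs with ∈-++⁻ as (xs⊆ys (there y∈xs))
    ... | inj₁ y∈as          = ∈-++⁺ˡ y∈as
    ... | inj₂ (here refl)   = contradiction refl (All.lookup x∉xs y∈xs)
    ... | inj₂ (there y∈bs)  = ∈-++⁺ʳ as y∈bs

  module _ (_≟_ : DecidableEquality A) where
    open import Data.List.Membership.DecPropositional _≟_ using (_∈?_)

    -- The tool for choosing field elements by counting: square roots, an auxiliary scalar, and
    -- later `β` and `ƛ` are all found outside a list shorter than the supply.
    ∃-fresh : ∀ {xs ys : List A} → Unique xs → length ys ℕ.< length xs → ∃[ x ] (x ∈ xs × x ∉ ys)
    ∃-fresh {xs} {ys} u ys<xs with any? (λ x → ¬? (x ∈? ys)) xs
    ... | yes p  = find p
    ... | no ¬p  = contradiction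
      (unique-⊆⇒length≤ u (λ {x} x∈xs → decidable-stable (x ∈? ys) (λ x∉ys → ¬p (lose x∈xs x∉ys))))
      (ℕ.<⇒≱ ys<xs)

length-cartesianProductWith : ∀ {A B C : Set} (f : A → B → C) xs ys →
  length (cartesianProductWith f xs ys) ≡ length xs ℕ.* length ys
length-cartesianProductWith f []       ys = refl
length-cartesianProductWith f (x ∷ xs) ys = trans (length-++ (map (f x) ys))
  (cong₂ ℕ._+_ (length-map (f x) ys) (length-cartesianProductWith f xs ys))

-- Preferred to `2 * j` because `double (suc j)` exposes two coordinates by computation, and
-- `suc (double (suc j))` is definitionally `3 + double j`: three plane coordinates followed by j
-- pairs.
double : ℕ → ℕ
double zero     = 0
double (suc j)  = suc (suc (double j))

double≡2* : ∀ m → double m ≡ 2 ℕ.* m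
double≡2* zero     = refl
double≡2* (suc m)  = cong suc (trans (cong suc (double≡2* m)) (sym (ℕ.+-suc m (m ℕ.+ 0))))

-- Finite fields of even order

module FieldProperties (F : FiniteField) where
  open FiniteField F

  commutativeRing : CommutativeRing _ _
  commutativeRing = record { isCommutativeRing = isCommutativeRing }

  open CommutativeRing commutativeRing public
    using (commutativeSemiring; semiring; ring; +-assoc; +-comm; +-identityˡ; +-identityʳ; *-assoc; *-comm
          ; *-identityˡ; *-identityʳ; zeroˡ; zeroʳ; distribˡ; distribʳ; +-isCommutativeMonoid)
  open RingProperties ring using (+-cancelˡ; +-cancelʳ)
  open Mult semiring using (×1-homo-*) renaming (_×_ to _ℕ×_)

  -- Made total by `inv 0# = 0#`, so that lists of excluded quotients can be formed before their
  -- denominators are known to be nonzero.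
  inv : Carrier → Carrier
  inv x with x ≟ 0#
  ... | yes _   = 0#
  ... | no x≢0  = proj₁ (inverse x x≢0)

  *-invʳ : ∀ {x} → x ≢ 0# → x * inv x ≡ 1#
  *-invʳ {x} x≢0 with x ≟ 0#
  ... | yes x≡0   = contradiction x≡0 x≢0
  ... | no x≢0′   = proj₂ (inverse x x≢0′)

  *-cancel-0 : ∀ {x y} → x ≢ 0# → x * y ≡ 0# → y ≡ 0#
  *-cancel-0 {x} {y} x≢0 xy≡0 = begin
    y                  ≡⟨ *-identityˡ y ⟨
    1# * y             ≡⟨ cong (_* y) (trans (*-comm (inv x) x) (*-invʳ x≢0)) ⟨
    (inv x * x) * y    ≡⟨ *-assoc (inv x) x y ⟩
    inv x * (x * y)    ≡⟨ cong (inv x *_) xy≡0 ⟩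
    inv x * 0#         ≡⟨ zeroʳ (inv x) ⟩
    0#                 ∎
    where open ≡-Reasoning

  integral : ∀ {x y} → x * y ≡ 0# → x ≡ 0# ⊎ y ≡ 0#
  integral {x} xy≡0 with x ≟ 0#
  ... | yes x≡0  = inj₁ x≡0
  ... | no x≢0   = inj₂ (*-cancel-0 x≢0 xy≡0)

  *-≢0 : ∀ {x y} → x ≢ 0# → y ≢ 0# → x * y ≢ 0#
  *-≢0 x≢0 y≢0 xy≡0 = y≢0 (*-cancel-0 x≢0 xy≡0)

  inv≢0 : ∀ {x} → x ≢ 0# → inv x ≢ 0#
  inv≢0 {x} x≢0 e = 0≢1 (trans (sym (zeroʳ x)) (trans (cong (x *_) (sym e)) (*-invʳ x≢0)))

  Σ-list : List Carrier → Carrier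
  Σ-list = foldr _+_ 0#

  Σ-list-shift : ∀ xs → Σ-list (map (1# +_) xs) ≡ (length xs ℕ× 1#) + Σ-list xs
  Σ-list-shift []        = sym (+-identityˡ 0#)
  Σ-list-shift (x ∷ xs)  = begin
    (1# + x) + Σ-list (map (1# +_) xs)   ≡⟨ cong ((1# + x) +_) (Σ-list-shift xs) ⟩
    (1# + x) + (n + s)                   ≡⟨ +-assoc 1# x (n + s) ⟩
    1# + (x + (n + s))
      ≡⟨ cong (1# +_) (trans (sym (+-assoc x n s)) (trans (cong (_+ s) (+-comm x n)) (+-assoc n x s))) ⟩
    1# + (n + (x + s))                   ≡⟨ +-assoc 1# n (x + s) ⟨
    (1# + n) + (x + s)                   ∎
    where
    open ≡-Reasoning
    n = length xs ℕ× 1#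
    s = Σ-list xs

  shift-elements : map (1# +_) elements ↭ elements
  shift-elements = ∼bag⇒↭ (unique∧set⇒bag (Unique.map⁺ (+-cancelˡ 1# _ _) distinct) distinct
    (λ {x} → mk⇔ (λ _ → complete x)
      (λ _ → subst (_∈ map (1# +_) elements) (unshift x) (∈-map⁺ (1# +_) (complete ((- 1#) + x))))))
    where
    open CommutativeRing commutativeRing using (-‿inverseʳ)
    unshift : ∀ x → 1# + ((- 1#) + x) ≡ x
    unshift x = trans (sym (+-assoc 1# (- 1#) x)) (trans (cong (_+ x) (-‿inverseʳ 1#)) (+-identityˡ x))

  -- Translation by `1#` permutes the field, so the sum of all elements equals itself plus q times
  -- `1#`; cancel the sum.
  order×1≡0 : order ℕ× 1# ≡ 0#
  order×1≡0 = +-cancelʳ (Σ-list elements) _ _ (begin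
    (order ℕ× 1#) + Σ-list elements   ≡⟨ Σ-list-shift elements ⟨
    Σ-list (map (1# +_) elements)
      ≡⟨ foldr-commMonoid (setoid Carrier) +-isCommutativeMonoid (↭⇒↭ₛ shift-elements) ⟩
    Σ-list elements                   ≡⟨ +-identityˡ _ ⟨
    0# + Σ-list elements              ∎)
    where open ≡-Reasoning

  -- The multiple is a power of 1 + 1, and there are no zero divisors; the exponent 0 would give 1 =
  -- 0.
  2^h×1≡0⇒1+1≡0 : ∀ h → (2 ℕ.^ h) ℕ× 1# ≡ 0# → 1# + 1# ≡ 0#
  2^h×1≡0⇒1+1≡0 zero e = contradiction (sym (trans (sym (+-identityʳ 1#)) e)) 0≢1
  2^h×1≡0⇒1+1≡0 (suc h) e with integral (trans (sym (×1-homo-* 2 (2 ℕ.^ h))) e)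
  ... | inj₁ e₂  = trans (cong (1# +_) (sym (+-identityʳ 1#))) e₂
  ... | inj₂ e₂  = 2^h×1≡0⇒1+1≡0 h e₂

  order≡2^h⇒1+1≡0 : ∀ h → order ≡ 2 ℕ.^ h → 1# + 1# ≡ 0#
  order≡2^h⇒1+1≡0 h e = 2^h×1≡0⇒1+1≡0 h (trans (cong (_ℕ× 1#) (sym e)) order×1≡0)

module Characteristic2 (F : FiniteField)
    (1+1≡0 : FiniteField._+_ F (FiniteField.1# F) (FiniteField.1# F) ≡ FiniteField.0# F) where
  open FiniteField F renaming (_+_ to infixl 6 _+_; _*_ to infixl 7 _*_)
  open FieldProperties F
  open Geometry F

  fromBool : Bool → Carrier
  fromBool true   = 1#
  fromBool false  = 0#

  private
    ring₂ : AlmostCommutativeRing _ _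
    ring₂ = fromCommutativeSemiring commutativeSemiring

    𝔽₂ = CommutativeRing.rawRing Bool.xor-∧-commutativeRing

    fromBool-morphism : 𝔽₂ -Raw-AlmostCommutative⟶ ring₂
    fromBool-morphism = record
      { ⟦_⟧ = fromBool
      ; +-homo = λ { true true → sym 1+1≡0 ; true false → sym (+-identityʳ 1#) ; false _ → sym (+-identityˡ _) }
      ; *-homo = λ { true _ → sym (*-identityˡ _) ; false _ → sym (zeroˡ _) }
      ; -‿homo = λ _ → refl
      ; 0-homo = refl
      ; 1-homo = refl
      }

    fromBool-≟ : ∀ p q → Maybe (fromBool p ≡ fromBool q)
    fromBool-≟ true   true   = just refl
    fromBool-≟ false  false  = just refl
    fromBool-≟ _      _      = nothing

  -- With coefficients in 𝔽₂ the solver decides identities modulo 1 + 1 = 0.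
  module Solver = RingSolver 𝔽₂ ring₂ fromBool-morphism fromBool-≟
  open Solver using (solve; _:=_; _:+_; _:*_; con)

  x+x≡0 : ∀ x → x + x ≡ 0#
  x+x≡0 = solve 1 (λ x → x :+ x := con false) refl

  x+y≡0⇒x≡y : ∀ {x y} → x + y ≡ 0# → x ≡ y
  x+y≡0⇒x≡y {x} {y} e = begin
    x              ≡⟨ solve 2 (λ x y → x := (x :+ y) :+ y) refl x y ⟩
    (x + y) + y    ≡⟨ cong (_+ y) e ⟩
    0# + y         ≡⟨ +-identityˡ y ⟩
    y              ∎
    where open ≡-Reasoning

  x≡y⇒x+y≡0 : ∀ {x y} → x ≡ y → x + y ≡ 0#
  x≡y⇒x+y≡0 {x} refl = x+x≡0 x

  -- Additivity of squaring turns the hypothesis into (x + y)² = 0.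
  square-injective : ∀ {x y} → x * x ≡ y * y → x ≡ y
  square-injective {x} {y} e with integral
      (trans (solve 2 (λ x y → (x :+ y) :* (x :+ y) := x :* x :+ y :* y) refl x y) (x≡y⇒x+y≡0 e))
  ... | inj₁ e₂ = x+y≡0⇒x≡y e₂
  ... | inj₂ e₂ = x+y≡0⇒x≡y e₂

  -- An injective self-map of a finite set is onto: the squares are as numerous as the field, hence
  -- do not all fit into the field with z removed.
  sqrt : ∀ z → ∃[ x ] (x * x ≡ z)
  sqrt z with ∃-fresh _≟_ {ys = filter (λ y → ¬? (y ≟ z)) elements} (Unique.map⁺ square-injective distinct)
               (ℕ.<-≤-trans (filter-notAll (λ y → ¬? (y ≟ z)) elements
                   (Any.map (λ { refl ¬e → ¬e refl }) (complete z)))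
                 (ℕ.≤-reflexive (sym (length-map (λ x → x * x) elements))))
  ... | y , y∈squares , y∉ with ∈-map⁻ (λ x → x * x) y∈squares
  ...   | x , _ , refl = x , decidable-stable (_ ≟ z) (λ y≢z → y∉ (∈-filter⁺ (λ y → ¬? (y ≟ z)) (complete _) y≢z))

  -- Vectors and linear independence in characteristic 2.

  private variable
    n : ℕ
    a b c : Carrier
    X Y Z : Vec Carrier n

  _≟ᵛ_ : DecidableEquality (Vec Carrier n)
  _≟ᵛ_ = Vec.≡-dec _≟_

  lin₂ : Carrier → Vec Carrier n → Carrier → Vec Carrier n → Vec Carrier n
  lin₂ a X b Y = (a · X) ⊕ (b · Y)

  lin₃ : Carrier → Vec Carrier n → Carrier → Vec Carrier n → Carrier → Vec Carrier n → Vec Carrier n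
  lin₃ a X b Y c Z = lin₂ a X b Y ⊕ (c · Z)

  ·-assoc : ∀ a b (X : Vec Carrier n) → a · (b · X) ≡ (a * b) · X
  ·-assoc a b []       = refl
  ·-assoc a b (x ∷ X)  = cong₂ _∷_ (sym (*-assoc a b x)) (·-assoc a b X)

  ·-identity : ∀ (X : Vec Carrier n) → 1# · X ≡ X
  ·-identity []       = refl
  ·-identity (x ∷ X)  = cong₂ _∷_ (*-identityˡ x) (·-identity X)

  ·-zeroˡ : ∀ (X : Vec Carrier n) → 0# · X ≡ zeroV
  ·-zeroˡ []       = refl
  ·-zeroˡ (x ∷ X)  = cong₂ _∷_ (zeroˡ x) (·-zeroˡ X)

  ·-zeroʳ : ∀ n a → a · zeroV {n} ≡ zeroV
  ·-zeroʳ zero    a = refl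
  ·-zeroʳ (suc n) a = cong₂ _∷_ (zeroʳ a) (·-zeroʳ n a)

  ⊕-identityˡ : ∀ (X : Vec Carrier n) → zeroV ⊕ X ≡ X
  ⊕-identityˡ []       = refl
  ⊕-identityˡ (x ∷ X)  = cong₂ _∷_ (+-identityˡ x) (⊕-identityˡ X)

  ⊕-identityʳ : ∀ (X : Vec Carrier n) → X ⊕ zeroV ≡ X
  ⊕-identityʳ []       = refl
  ⊕-identityʳ (x ∷ X)  = cong₂ _∷_ (+-identityʳ x) (⊕-identityʳ X)

  ⊕-comm : ∀ (X Y : Vec Carrier n) → X ⊕ Y ≡ Y ⊕ X
  ⊕-comm []      []       = refl
  ⊕-comm (x ∷ X) (y ∷ Y)  = cong₂ _∷_ (+-comm x y) (⊕-comm X Y)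

  ⊕-assoc : ∀ (X Y Z : Vec Carrier n) → (X ⊕ Y) ⊕ Z ≡ X ⊕ (Y ⊕ Z)
  ⊕-assoc []      []      []       = refl
  ⊕-assoc (x ∷ X) (y ∷ Y) (z ∷ Z)  = cong₂ _∷_ (+-assoc x y z) (⊕-assoc X Y Z)

  ·-distribˡ : ∀ a (X Y : Vec Carrier n) → a · (X ⊕ Y) ≡ lin₂ a X a Y
  ·-distribˡ a []      []       = refl
  ·-distribˡ a (x ∷ X) (y ∷ Y)  = cong₂ _∷_ (distribˡ a x y) (·-distribˡ a X Y)

  ·-distribʳ : ∀ a b (X : Vec Carrier n) → lin₂ a X b X ≡ (a + b) · X
  ·-distribʳ a b []       = refl
  ·-distribʳ a b (x ∷ X)  = cong₂ _∷_ (sym (distribʳ x a b)) (·-distribʳ a b X)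

  ·-lin₂ : ∀ c a (X : Vec Carrier n) b Y → c · lin₂ a X b Y ≡ lin₂ (c * a) X (c * b) Y
  ·-lin₂ c a X b Y = trans (·-distribˡ c _ _) (cong₂ _⊕_ (·-assoc c a X) (·-assoc c b Y))

  ⊕-self : ∀ (X : Vec Carrier n) → X ⊕ X ≡ zeroV
  ⊕-self []       = refl
  ⊕-self (x ∷ X)  = cong₂ _∷_ (x+x≡0 x) (⊕-self X)

  X≡Y⇒X⊕Y≡0 : X ≡ Y → X ⊕ Y ≡ zeroV
  X≡Y⇒X⊕Y≡0 {X = X} refl = ⊕-self X

  X⊕Y≡0⇒X≡Y : X ⊕ Y ≡ zeroV → X ≡ Y
  X⊕Y≡0⇒X≡Y {X = X} {Y} e = begin
    X              ≡⟨ ⊕-identityʳ X ⟨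
    X ⊕ zeroV      ≡⟨ cong (X ⊕_) (⊕-self Y) ⟨
    X ⊕ (Y ⊕ Y)    ≡⟨ ⊕-assoc X Y Y ⟨
    (X ⊕ Y) ⊕ Y    ≡⟨ cong (_⊕ Y) e ⟩
    zeroV ⊕ Y      ≡⟨ ⊕-identityˡ Y ⟩
    Y              ∎
    where open ≡-Reasoning

  ·-cancel-inv : a ≢ 0# → a · X ≡ Y → X ≡ inv a · Y
  ·-cancel-inv {a} {X = X} a≢0 refl = begin
    X                  ≡⟨ ·-identity X ⟨
    1# · X             ≡⟨ cong (_· X) (trans (*-comm (inv a) a) (*-invʳ a≢0)) ⟨
    (inv a * a) · X    ≡⟨ ·-assoc (inv a) a X ⟨
    inv a · (a · X)    ∎
    where open ≡-Reasoning

  ·-rescale : a ≢ 0# → Y ≡ a · X → b · X ≡ (b * inv a) · Y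
  ·-rescale {b = b} a≢0 e = trans (cong (b ·_) (·-cancel-inv a≢0 (sym e))) (·-assoc _ _ _)

  ·≡0⇒a≡0 : X ≢ zeroV → a · X ≡ zeroV → a ≡ 0#
  ·≡0⇒a≡0 {n} {X} {a} X≢0 e with a ≟ 0#
  ... | yes a≡0  = a≡0
  ... | no a≢0   = contradiction (trans (·-cancel-inv a≢0 e) (·-zeroʳ n (inv a))) X≢0

  ·-cancel : a ≢ 0# → a · X ≡ a · Y → X ≡ Y
  ·-cancel {a} {X = X} {Y} a≢0 e = trans (·-cancel-inv a≢0 e) (sym (·-cancel-inv a≢0 refl))

  Indep₂ : Vec Carrier n → Vec Carrier n → Set
  Indep₂ X Y = ∀ a b → lin₂ a X b Y ≡ zeroV → a ≡ 0# × b ≡ 0#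

  Indep₃ : Vec Carrier n → Vec Carrier n → Vec Carrier n → Set
  Indep₃ X Y Z = ∀ a b c → lin₃ a X b Y c Z ≡ zeroV → a ≡ 0# × b ≡ 0# × c ≡ 0#

  indep₂-swap : Indep₂ X Y → Indep₂ Y X
  indep₂-swap i a b e with i b a (trans (⊕-comm _ _) e)
  ... | b≡0 , a≡0 = a≡0 , b≡0

  indep₃-swap₁₂ : Indep₃ X Y Z → Indep₃ Y X Z
  indep₃-swap₁₂ i a b c e with i b a c (trans (cong (_⊕ _) (⊕-comm _ _)) e)
  ... | b≡0 , a≡0 , c≡0 = a≡0 , b≡0 , c≡0

  lin₃-swap₂₃ : ∀ a (X : Vec Carrier n) b Y c Z → lin₃ a X b Y c Z ≡ lin₃ a X c Z b Y
  lin₃-swap₂₃ a X b Y c Z = begin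
    ((a · X) ⊕ (b · Y)) ⊕ (c · Z)   ≡⟨ ⊕-assoc _ _ _ ⟩
    (a · X) ⊕ ((b · Y) ⊕ (c · Z))   ≡⟨ cong ((a · X) ⊕_) (⊕-comm _ _) ⟩
    (a · X) ⊕ ((c · Z) ⊕ (b · Y))   ≡⟨ ⊕-assoc _ _ _ ⟨
    ((a · X) ⊕ (c · Z)) ⊕ (b · Y)   ∎
    where open ≡-Reasoning

  indep₃-swap₂₃ : Indep₃ X Y Z → Indep₃ X Z Y
  indep₃-swap₂₃ i a b c e with i a c b (trans (lin₃-swap₂₃ a _ c _ b _) e)
  ... | a≡0 , c≡0 , b≡0 = a≡0 , b≡0 , c≡0

  indep₂⇒≢0 : Indep₂ X Y → X ≢ zeroV
  indep₂⇒≢0 {n} {Y = Y} i refl with i 1# 0# (trans (cong₂ _⊕_ (·-zeroʳ n 1#) (·-zeroˡ Y)) (⊕-identityˡ _))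
  ... | 1≡0 , _ = 0≢1 (sym 1≡0)

  indep₃⇒indep₂ : Indep₃ X Y Z → Indep₂ X Y
  indep₃⇒indep₂ {Z = Z} i a b e with i a b 0# (trans (cong₂ _⊕_ e (·-zeroˡ Z)) (⊕-identityˡ _))
  ... | a≡0 , b≡0 , _ = a≡0 , b≡0

  indep₂-coefficients : Indep₂ X Y → ∀ {a b a′ b′} → lin₂ a X b Y ≡ lin₂ a′ X b′ Y → a ≡ a′ × b ≡ b′
  indep₂-coefficients {X = X} {Y} i {a} {b} {a′} {b′} e
    with i (a + a′) (b + b′) (trans (regroup X Y) (X≡Y⇒X⊕Y≡0 e))
    where
    regroup : ∀ {n} (X Y : Vec Carrier n) → lin₂ (a + a′) X (b + b′) Y ≡ lin₂ a X b Y ⊕ lin₂ a′ X b′ Y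
    regroup []      []       = refl
    regroup (x ∷ X) (y ∷ Y)  = cong₂ _∷_
      (solve 6 (λ a a′ b b′ x y → (a :+ a′) :* x :+ (b :+ b′) :* y := (a :* x :+ b :* y) :+
          (a′ :* x :+ b′ :* y)) refl a a′ b b′ x y)
      (regroup X Y)
  ... | e₁ , e₂ = x+y≡0⇒x≡y e₁ , x+y≡0⇒x≡y e₂

  indep₃-scale : ∀ {r s t} → r ≢ 0# → s ≢ 0# → t ≢ 0# → Indep₃ X Y Z → Indep₃ (r · X) (s · Y) (t · Z)
  indep₃-scale {X = X} {Y} {Z} {r} {s} {t} r≢0 s≢0 t≢0 i a b c e
    with i (a * r) (b * s) (c * t) (trans
        (sym (cong₂ _⊕_ (cong₂ _⊕_ (·-assoc a r X) (·-assoc b s Y)) (·-assoc c t Z))) e)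
  ... | e₁ , e₂ , e₃ = cancel r≢0 e₁ , cancel s≢0 e₂ , cancel t≢0 e₃
    where
    cancel : ∀ {x y} → y ≢ 0# → x * y ≡ 0# → x ≡ 0#
    cancel {x} {y} y≢0 xy≡0 = *-cancel-0 y≢0 (trans (*-comm y x) xy≡0)

  -- Caps given by arbitrary homogeneous coordinate vectors

  record ProjectiveCap (L : List (Vec Carrier n)) : Set where
    field
      nonzero  : X ∈ L → X ≢ zeroV
      indep₂   : X ∈ L → Y ∈ L → X ≢ Y → Indep₂ X Y
      indep₃   : X ∈ L → Y ∈ L → Z ∈ L → X ≢ Y → X ≢ Z → Y ≢ Z → Indep₃ X Y Z

  -- Y = Z is allowed, so points of L count as covered.
  Covers : List (Vec Carrier n) → Set
  Covers L = ∀ X → ∃[ Y ] ∃[ Z ] (Y ∈ L × Z ∈ L × ∃[ α ] ∃[ β ] X ≡ lin₂ α Y β Z)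

  normalized⇒≢0 : Normalized X → X ≢ zeroV
  normalized⇒≢0 {X = x ∷ X} (inj₁ refl) e = 0≢1 (sym (Vec.∷-injectiveˡ e))
  normalized⇒≢0 {X = x ∷ X} (inj₂ (_ , nX)) e = normalized⇒≢0 nX (Vec.∷-injectiveʳ e)

  leading-indep₂ : ∀ (X : Vec Carrier n) → Normalized Y → Indep₂ (1# ∷ X) (0# ∷ Y)
  leading-indep₂ {Y = Y} X nY a b e with
    trans (solve 2 (λ a b → a := a :* con true :+ b :* con false) refl a b) (Vec.∷-injectiveˡ e)
  ... | refl = refl , ·≡0⇒a≡0 (normalized⇒≢0 nY)
    (trans (sym (trans (cong (_⊕ (b · Y)) (·-zeroˡ X)) (⊕-identityˡ _))) (Vec.∷-injectiveʳ e))

  normalized-indep₂ : Normalized X → Normalized Y → X ≢ Y → Indep₂ X Y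
  normalized-indep₂ {X = x ∷ X} {y ∷ Y} (inj₁ refl) (inj₁ refl) X≢Y a b e = a≡0 , trans (sym a≡b) a≡0
    where
    a≡b : a ≡ b
    a≡b = x+y≡0⇒x≡y (trans (sym (cong₂ _+_ (*-identityʳ a) (*-identityʳ b))) (Vec.∷-injectiveˡ e))
    a≡0 : a ≡ 0#
    a≡0 with a ≟ 0#
    ... | yes a≡0  = a≡0
    ... | no a≢0   = contradiction
      (·-cancel a≢0 (X⊕Y≡0⇒X≡Y (trans (cong (λ c → lin₂ a (1# ∷ X) c (1# ∷ Y)) a≡b) e))) X≢Y
  normalized-indep₂ {X = x ∷ X} {y ∷ Y} (inj₁ refl) (inj₂ (refl , nY)) X≢Y = leading-indep₂ X nY
  normalized-indep₂ {X = x ∷ X} {y ∷ Y} (inj₂ (refl , nX)) (inj₁ refl) X≢Y = indep₂-swap (leading-indep₂ Y nX)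
  normalized-indep₂ {X = x ∷ X} {y ∷ Y} (inj₂ (refl , nX)) (inj₂ (refl , nY)) X≢Y a b e =
    normalized-indep₂ nX nY (λ { refl → X≢Y refl }) a b (Vec.∷-injectiveʳ e)

  normalized-proportional : Normalized X → Normalized Y → X ≡ a · Y → X ≡ Y
  normalized-proportional {X = X} {Y} {a} nX nY e with X ≟ᵛ Y
  ... | yes X≡Y  = X≡Y
  ... | no X≢Y   = contradiction
    (sym (proj₁ (normalized-indep₂ nX nY X≢Y 1# a (X≡Y⇒X⊕Y≡0 (trans (·-identity X) e))))) 0≢1

  normalise : (X : Vec Carrier n) → X ≢ zeroV → ∃[ s ] (s ≢ 0# × Normalized (s · X))
  normalise []      X≢0 = contradiction refl X≢0
  normalise (x ∷ X) X≢0 with x ≟ 0#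
  ... | no x≢0    = inv x , inv≢0 x≢0 , inj₁ (trans (*-comm (inv x) x) (*-invʳ x≢0))
  ... | yes refl with normalise X (λ { refl → X≢0 refl })
  ...   | s , s≢0 , nX = s , s≢0 , inj₂ (zeroʳ s , nX)

  cap⇒projectiveCap : ∀ {N} {K : List (Vector N)} → Cap K → ProjectiveCap K
  cap⇒projectiveCap {K = K} (_ , normalized , noncollinear) = record
    { nonzero  = λ X∈K → normalized⇒≢0 (All.lookup normalized X∈K)
    ; indep₂   = λ X∈K Y∈K → normalized-indep₂ (All.lookup normalized X∈K) (All.lookup normalized Y∈K)
    ; indep₃   = λ X∈K Y∈K Z∈K X≢Y X≢Z Y≢Z → ¬collinear⇒indep₃ (noncollinear X∈K Y∈K Z∈K X≢Y X≢Z Y≢Z)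
    }
    where
    ¬collinear⇒indep₃ : ∀ {N} {X Y Z : Vector N} → ¬ Collinear X Y Z → Indep₃ X Y Z
    ¬collinear⇒indep₃ ¬col a b c e with a ≟ 0# | b ≟ 0# | c ≟ 0#
    ... | yes p | yes q | yes r = p , q , r
    ... | no ¬p | _ | _ = contradiction (a , b , c , (λ { (p , _) → ¬p p }) , e) ¬col
    ... | _ | no ¬p | _ = contradiction (a , b , c , (λ { (_ , p , _) → ¬p p }) , e) ¬col
    ... | _ | _ | no ¬p = contradiction (a , b , c , (λ { (_ , _ , p) → ¬p p }) , e) ¬col

  -- From homogeneous vectors to a complete cap in normalized form.

  module Normalisation {N} (L : List (Vector N)) (cap : ProjectiveCap L) where
    open ProjectiveCap cap

    norm : Vector N → Vector N
    norm X with X ≟ᵛ zeroV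
    ... | yes _   = X
    ... | no X≢0  = proj₁ (normalise X X≢0) · X

    norm-spec : ∀ {X} → X ∈ L → Normalized (norm X) × ∃[ s ] (s ≢ 0# × norm X ≡ s · X)
    norm-spec {X} X∈L with X ≟ᵛ zeroV
    ... | yes X≡0  = contradiction X≡0 (nonzero X∈L)
    ... | no X≢0   with normalise X X≢0
    ...   | s , s≢0 , n = n , s , s≢0 , refl

    -- Deduplication supplies `Unique` and can only shorten the list, which suits an upper bound on
    -- the size.
    normalisation : List (Vector N)
    normalisation = deduplicate _≟ᵛ_ (map norm L)

    ∈-normalisation⁻ : ∀ {P} → P ∈ normalisation → ∃[ X ] (X ∈ L × P ≡ norm X)
    ∈-normalisation⁻ P∈ = ∈-map⁻ norm (∈-deduplicate⁻ _≟ᵛ_ (map norm L) P∈)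

    ∈-normalisation⁺ : ∀ {X} → X ∈ L → norm X ∈ normalisation
    ∈-normalisation⁺ X∈L = ∈-deduplicate⁺ _≟ᵛ_ (∈-map⁺ norm X∈L)

    length-normalisation : length normalisation ℕ.≤ length L
    length-normalisation = ℕ.≤-trans (length-deduplicate _≟ᵛ_ (map norm L)) (ℕ.≤-reflexive (length-map norm L))

    normalisation-normalized : ∀ {P} → P ∈ normalisation → Normalized P
    normalisation-normalized P∈ with ∈-normalisation⁻ P∈
    ... | X , X∈L , refl = proj₁ (norm-spec X∈L)

    normalisation-cap : Cap normalisation
    normalisation-cap = deduplicate-! _≟ᵛ_ (map norm L) , All.tabulate normalisation-normalized , noncollinear
      where
      noncollinear : ∀ {P Q R} → P ∈ normalisation → Q ∈ normalisation → R ∈ normalisation →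
        P ≢ Q → P ≢ R → Q ≢ R → ¬ Collinear P Q R
      noncollinear P∈ Q∈ R∈ P≢Q P≢R Q≢R (a , b , c , ¬zero , e)
        with ∈-normalisation⁻ P∈ | ∈-normalisation⁻ Q∈ | ∈-normalisation⁻ R∈
      ... | X , X∈L , refl | Y , Y∈L , refl | Z , Z∈L , refl
        with norm-spec X∈L | norm-spec Y∈L | norm-spec Z∈L
      ... | _ , r , r≢0 , eX | _ , s , s≢0 , eY | _ , t , t≢0 , eZ =
        ¬zero (indep₃-scale r≢0 s≢0 t≢0
          (indep₃ X∈L Y∈L Z∈L (λ X≡Y → P≢Q (cong norm X≡Y)) (λ X≡Z → P≢R (cong norm X≡Z))
              (λ Y≡Z → Q≢R (cong norm Y≡Z)))
          a b c (trans (sym (cong₂ _⊕_ (cong₂ (λ X Y → lin₂ a X b Y) eX eY) (cong (c ·_) eZ))) e))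

    -- The two vectors that cover P either normalize to one point, which is then P itself, or to two
    -- points collinear with P.
    normalisation-complete : Covers L → ∀ P → Normalized P → P ∉ normalisation → ¬ Cap (P ∷ normalisation)
    normalisation-complete covers P nP P∉ (_ , _ , noncollinear) with covers P
    ... | Y , Z , Y∈L , Z∈L , α , β , P≡ with norm-spec Y∈L | norm-spec Z∈L
    ... | nY , s , s≢0 , eY | nZ , t , t≢0 , eZ with norm Y ≟ᵛ norm Z
    ... | yes Y≡Z = P∉ (subst (_∈ normalisation)
      (sym (normalized-proportional nP nY
          (trans (trans P≡ (cong₂ _⊕_ (·-rescale s≢0 eY) (·-rescale t≢0 eZ)))
              (trans (cong (λ Z → lin₂ _ (norm Y) _ Z) (sym Y≡Z)) (·-distribʳ _ _ _))))) (∈-normalisation⁺ Y∈L))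
    ... | no Y≢Z = noncollinear (here refl) (there (∈-normalisation⁺ Y∈L)) (there (∈-normalisation⁺ Z∈L))
        (λ { refl → P∉ (∈-normalisation⁺ Y∈L) }) (λ { refl → P∉ (∈-normalisation⁺ Z∈L) }) Y≢Z
        (1# , α * inv s , β * inv t , (λ { (1≡0 , _) → 0≢1 (sym 1≡0) }) ,
          trans (⊕-assoc _ _ _) (X≡Y⇒X⊕Y≡0
              (trans (·-identity P) (trans P≡ (cong₂ _⊕_ (·-rescale s≢0 eY) (·-rescale t≢0 eZ))))))

  -- Parabolas

  private variable
    j : ℕ

  enc : Vec Carrier j → Vec Carrier (double j)
  enc []       = []
  enc (x ∷ v)  = x ∷ x * x ∷ enc v

  enc-injective : ∀ {x y : Vec Carrier j} → enc x ≡ enc y → x ≡ y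
  enc-injective {x = []}    {[]}     _ = refl
  enc-injective {x = x ∷ v} {y ∷ w}  e = cong₂ _∷_ (Vec.∷-injectiveˡ e)
    (enc-injective (Vec.∷-injectiveʳ (Vec.∷-injectiveʳ e)))

  -- The equations of the vectors κ · (enc x ⊕ enc y): with s = x + y each pair is (κ s, κ s²), and
  -- κ · κ s² = (κ s)². One κ serves all pairs.
  Parabolic : ∀ j → Carrier → Vec Carrier (double j) → Set
  Parabolic zero     κ []           = ⊤
  Parabolic (suc j)  κ (x ∷ y ∷ t)  = κ * y ≡ x * x × Parabolic j κ t

  -- Pair by pair: eliminating y by y = (a + c₁ x) / c₂ from c₁ x² + c₂ y² = b leaves c₁ (c₂ + c₁)
  -- x² = b c₂ + a². The leading coefficient is nonzero precisely because c₁ ≠ c₂, and a square root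
  -- then gives x.
  enc-cover : ∀ {c₁ c₂} → c₁ ≢ 0# → c₂ ≢ 0# → c₁ ≢ c₂ →
    ∀ j (t : Vec Carrier (double j)) → ∃[ x ] ∃[ y ] t ≡ lin₂ c₁ (enc {j} x) c₂ (enc {j} y)
  enc-cover _ _ _ zero [] = [] , [] , refl
  enc-cover {c₁} {c₂} c₁≢0 c₂≢0 c₁≢c₂ (suc j) (a ∷ b ∷ t)
    with enc-cover c₁≢0 c₂≢0 c₁≢c₂ j t | sqrt ((b * c₂ + a * a) * inv (c₁ * (c₂ + c₁)))
  ... | v , w , t≡ | x , x² = x ∷ v , y ∷ w , cong₂ _∷_ (sym first) (cong₂ _∷_ (sym second) t≡)
    where
    open ≡-Reasoning
    i = inv c₂
    y = (a + c₁ * x) * i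
    d = c₁ * (c₂ + c₁)

    d≢0 : d ≢ 0#
    d≢0 = *-≢0 c₁≢0 (λ e → c₁≢c₂ (sym (x+y≡0⇒x≡y e)))

    dx² : d * (x * x) ≡ b * c₂ + a * a
    dx² = begin
      d * (x * x)                            ≡⟨ cong (d *_) x² ⟩
      d * ((b * c₂ + a * a) * inv d)         ≡⟨ solve 3 (λ d e f → d :* (e :* f) := (d :* f) :* e) refl d _ (inv d) ⟩
      (d * inv d) * (b * c₂ + a * a)         ≡⟨ cong (_* _) (*-invʳ d≢0) ⟩
      1# * (b * c₂ + a * a)                  ≡⟨ *-identityˡ _ ⟩
      b * c₂ + a * a                         ∎

    first : c₁ * x + c₂ * y ≡ a
    first = begin
      c₁ * x + c₂ * ((a + c₁ * x) * i)
        ≡⟨ solve 5 (λ c d a x i → c :* x :+ d :* ((a :+ c :* x) :* i) := c :* x :+ (d :* i) :* (a :+ c :* x))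
            refl c₁ c₂ a x i ⟩
      c₁ * x + (c₂ * i) * (a + c₁ * x)   ≡⟨ cong (λ k → c₁ * x + k * (a + c₁ * x)) (*-invʳ c₂≢0) ⟩
      c₁ * x + 1# * (a + c₁ * x)         ≡⟨ solve 3 (λ c a x → c :* x :+ con true :* (a :+ c :* x) := a) refl c₁ a x ⟩
      a                                  ∎

    second : c₁ * (x * x) + c₂ * (y * y) ≡ b
    second = begin
      c₁ * (x * x) + c₂ * (y * y)
        ≡⟨ solve 5 (λ c d a x i → c :* (x :* x) :+ d :* (((a :+ c :* x) :* i) :* ((a :+ c :* x) :* i))
             := c :* (x :* x) :+ ((d :* i) :* i) :* (a :* a :+ c :* c :* (x :* x))) refl c₁ c₂ a x i ⟩
      c₁ * (x * x) + ((c₂ * i) * i) * (a * a + c₁ * c₁ * (x * x))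
        ≡⟨ cong₂ _+_ (trans (sym (*-identityˡ _)) (cong (_* (c₁ * (x * x))) (sym (*-invʳ c₂≢0))))
                     (cong (λ k → (k * i) * (a * a + c₁ * c₁ * (x * x))) (*-invʳ c₂≢0)) ⟩
      (c₂ * i) * (c₁ * (x * x)) + (1# * i) * (a * a + c₁ * c₁ * (x * x))
        ≡⟨ solve 5 (λ c d a x i → (d :* i) :* (c :* (x :* x)) :+ (con true :* i) :* (a :* a :+ c :* c :* (x :* x))
             := i :* (c :* (d :+ c) :* (x :* x) :+ a :* a)) refl c₁ c₂ a x i ⟩
      i * (d * (x * x) + a * a)       ≡⟨ cong (λ k → i * (k + a * a)) dx² ⟩
      i * ((b * c₂ + a * a) + a * a)
        ≡⟨ solve 4 (λ i b c a → i :* ((b :* c :+ a :* a) :+ a :* a) := (c :* i) :* b) refl i b c₂ a ⟩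
      (c₂ * i) * b                    ≡⟨ cong (_* b) (*-invʳ c₂≢0) ⟩
      1# * b                          ≡⟨ *-identityˡ b ⟩
      b                               ∎

  -- Dividing by a gives t = κ · (enc x ⊕ enc y) with κ = b / a; equal coefficients on both
  -- encodings are essential.
  enc-parabolic : ∀ j {a b} (t : Vec Carrier (double j)) (x y : Vec Carrier j) → a ≢ 0# →
    lin₃ a t b (enc x) b (enc y) ≡ zeroV → Parabolic j (b * inv a) t
  enc-parabolic zero [] [] [] a≢0 e = tt
  enc-parabolic (suc j) {a} {b} (p ∷ q ∷ t) (x ∷ v) (y ∷ w) a≢0 e =
    on-parabola , enc-parabolic j t v w a≢0 (Vec.∷-injectiveʳ (Vec.∷-injectiveʳ e))
    where
    open ≡-Reasoning
    i = inv a

    solve-for : ∀ {r z} → a * r + z ≡ 0# → r ≡ i * z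
    solve-for {r} {z} e = begin
      r               ≡⟨ *-identityˡ r ⟨
      1# * r          ≡⟨ cong (_* r) (*-invʳ a≢0) ⟨
      (a * i) * r     ≡⟨ solve 3 (λ a i r → (a :* i) :* r := i :* (a :* r)) refl a i r ⟩
      i * (a * r)     ≡⟨ cong (i *_) (x+y≡0⇒x≡y e) ⟩
      i * z           ∎

    p≡ : p ≡ i * (b * x + b * y)
    p≡ = solve-for (trans (sym (+-assoc _ _ _)) (Vec.∷-injectiveˡ e))

    q≡ : q ≡ i * (b * (x * x) + b * (y * y))
    q≡ = solve-for (trans (sym (+-assoc _ _ _)) (Vec.∷-injectiveˡ (Vec.∷-injectiveʳ e)))

    on-parabola : (b * i) * q ≡ p * p
    on-parabola = begin
      (b * i) * q                                              ≡⟨ cong ((b * i) *_) q≡ ⟩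
      (b * i) * (i * (b * (x * x) + b * (y * y)))
        ≡⟨ solve 4 (λ b i x y → (b :* i) :* (i :* (b :* (x :* x) :+ b :* (y :* y)))
              := (i :* (b :* x :+ b :* y)) :* (i :* (b :* x :+ b :* y))) refl b i x y ⟩
      (i * (b * x + b * y)) * (i * (b * x + b * y))            ≡⟨ cong₂ _*_ p≡ p≡ ⟨
      p * p                                                    ∎

  -- At a coordinate where y and z differ, put s = a x + b y + c z and r = a x² + b y² + c z². Since
  -- a = b + c, the combination s² + a r equals b c (y + z)², and both s and r vanish.
  enc-collinear : ∀ {a b c} (x y z : Vec Carrier j) → a ≡ b + c →
    lin₃ a (enc x) b (enc y) c (enc z) ≡ zeroV → y ≢ z → b * c ≡ 0#
  enc-collinear [] [] [] _ _ y≢z = contradiction refl y≢z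
  enc-collinear {a = a} {b} {c} (x ∷ u) (y ∷ v) (z ∷ w) refl e y≢z with y ≟ z
  ... | yes refl  = enc-collinear u v w refl (Vec.∷-injectiveʳ (Vec.∷-injectiveʳ e)) (λ { refl → y≢z refl })
  ... | no y≢z′   with integral bc⟨y+z⟩²≡0
    where
    open ≡-Reasoning
    e₁ = Vec.∷-injectiveˡ e
    e₂ = Vec.∷-injectiveˡ (Vec.∷-injectiveʳ e)
    bc⟨y+z⟩²≡0 : (b * c) * ((y + z) * (y + z)) ≡ 0#
    bc⟨y+z⟩²≡0 = begin
      (b * c) * ((y + z) * (y + z))
        ≡⟨ solve 5 (λ b c x y z → (b :* c) :* ((y :+ z) :* (y :+ z)) :=
             let s = (b :+ c) :* x :+ b :* y :+ c :* z in
             s :* s :+ (b :+ c) :* ((b :+ c) :* (x :* x) :+ b :* (y :* y) :+ c :* (z :* z))) refl b c x y z ⟩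
      _ ≡⟨ cong₂ (λ s t → s * s + (b + c) * t) e₁ e₂ ⟩
      0# * 0# + (b + c) * 0#   ≡⟨ solve 1 (λ k → con false :* con false :+ k :* con false := con false) refl (b + c) ⟩
      0# ∎
  ...   | inj₁ bc≡0 = bc≡0
  ...   | inj₂ e₃ with integral e₃
  ...     | inj₁ y+z≡0 = contradiction (x+y≡0⇒x≡y y+z≡0) y≢z′
  ...     | inj₂ y+z≡0 = contradiction (x+y≡0⇒x≡y y+z≡0) y≢z′

  -- Blowing up a planar cap

  SecantCoefficient : List (Vec Carrier 3) → Vec Carrier 3 → Carrier → Set
  SecantCoefficient K Q c = ∃[ P₁ ] ∃[ P₂ ] (P₁ ∈ K × P₂ ∈ K × P₁ ≢ P₂ × Q ≡ lin₂ c P₁ c P₂)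

  -- (u , t) ↦ (u · Q) ++ t identifies F × F²ʲ with the span of Q and the last 2j coordinates;
  -- there, the bad points are those on a secant of {P ++ enc x | P ∈ K}.
  Bad : List (Vec Carrier 3) → Vec Carrier 3 → ∀ j → Vec Carrier (suc (double j)) → Set
  Bad K Q j (u ∷ t) = ∃[ κ ] (κ ≢ 0# × Parabolic j κ t × (u ≡ 0# ⊎ ∃[ c ] (SecantCoefficient K Q c × κ ≡ c * u)))

  -- The planar data in a form that survives linear maps, so nothing is assumed normalized. In
  -- `split` the points P₁ and P₂ may coincide, which accounts for multiples of a point of K.
  record SumPointCap (K : List (Vec Carrier 3)) (Q : Vec Carrier 3) : Set where
    field
      cap        : ProjectiveCap K
      covers     : Covers K
      Q-indep    : ∀ {P} → P ∈ K → Indep₂ Q P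
      Q-nonzero  : Q ≢ zeroV
      Q-sum      : ∀ {P₁ P₂ c₁ c₂} → P₁ ∈ K → P₂ ∈ K → P₁ ≢ P₂ → Q ≡ lin₂ c₁ P₁ c₂ P₂ → c₁ ≡ c₂
      split      : ∀ v → (∃[ u ] v ≡ u · Q) ⊎
                   (∃[ P₁ ] ∃[ P₂ ] ∃[ c₁ ] ∃[ c₂ ]
                       (P₁ ∈ K × P₂ ∈ K × c₁ ≢ 0# × c₂ ≢ 0# × c₁ ≢ c₂ × v ≡ lin₂ c₁ P₁ c₂ P₂))

  -- The plane is also the bottom level: its three coordinates are read as (u ; a, b), so badness
  -- with j = 1 makes sense for points of K and for Q themselves.
  record Seed (K : List (Vec Carrier 3)) (Q : Vec Carrier 3) : Set where
    field
      sumPointCap  : SumPointCap K Q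
      avoids       : ∀ {P} → P ∈ K → ¬ Bad K Q 1 P
      Q-avoids     : ¬ Bad K Q 1 Q
    open SumPointCap sumPointCap public

  vectors : ∀ j → List (Vec Carrier j)
  vectors zero     = [] ∷ []
  vectors (suc j)  = cartesianProductWith _∷_ elements (vectors j)

  ∈-vectors : ∀ {j} (x : Vec Carrier j) → x ∈ vectors j
  ∈-vectors []       = here refl
  ∈-vectors (x ∷ v)  = ∈-cartesianProductWith⁺ _∷_ (complete x) (∈-vectors v)

  length-vectors : ∀ j → length (vectors j) ≡ order ℕ.^ j
  length-vectors zero     = refl
  length-vectors (suc j)  = trans (length-cartesianProductWith _∷_ elements (vectors j))
      (cong (order ℕ.*_) (length-vectors j))

  lin₂-++ : ∀ {n} a (v : Vec Carrier 3) (s : Vec Carrier n) b w t →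
    lin₂ a (v ++ s) b (w ++ t) ≡ lin₂ a v b w ++ lin₂ a s b t
  lin₂-++ a (_ ∷ _ ∷ _ ∷ []) s b (_ ∷ _ ∷ _ ∷ []) t = refl

  ++≡0 : ∀ {n} (v : Vec Carrier 3) {t : Vec Carrier n} → v ++ t ≡ zeroV → v ≡ zeroV × t ≡ zeroV
  ++≡0 (_ ∷ _ ∷ _ ∷ []) refl = refl , refl

  lin₂-++≡0 : ∀ {n a b} (v w : Vec Carrier 3) {s t : Vec Carrier n} →
    lin₂ a (v ++ s) b (w ++ t) ≡ zeroV → lin₂ a v b w ≡ zeroV × lin₂ a s b t ≡ zeroV
  lin₂-++≡0 v w e = ++≡0 _ (trans (sym (lin₂-++ _ v _ _ w _)) e)

  lin₃-++≡0 : ∀ {n a b c} (u v w : Vec Carrier 3) {r s t : Vec Carrier n} →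
    lin₃ a (u ++ r) b (v ++ s) c (w ++ t) ≡ zeroV → lin₃ a u b v c w ≡ zeroV × lin₃ a r b s c t ≡ zeroV
  lin₃-++≡0 (_ ∷ _ ∷ _ ∷ []) (_ ∷ _ ∷ _ ∷ []) (_ ∷ _ ∷ _ ∷ []) e = ++≡0 (_ ∷ _ ∷ _ ∷ []) e

  lin₂-dropˡ : ∀ {n} (X : Vec Carrier n) {Y} → (0# · X) ⊕ Y ≡ Y
  lin₂-dropˡ X = trans (cong (_⊕ _) (·-zeroˡ X)) (⊕-identityˡ _)

  lin₂-dropʳ : ∀ {n} {X : Vec Carrier n} Y → X ⊕ (0# · Y) ≡ X
  lin₂-dropʳ Y = trans (cong (_ ⊕_) (·-zeroˡ Y)) (⊕-identityʳ _)

  module Step {K : List (Vec Carrier 3)} {Q : Vec Carrier 3} (seed : Seed K Q) where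
    open Seed seed
    open ProjectiveCap cap

    embed : ∀ {n} → Vec Carrier (suc n) → Vec Carrier (3 ℕ.+ n)
    embed (u ∷ t) = (u · Q) ++ t

    lin₂-embed : ∀ {n} a (X : Vec Carrier (suc n)) b Y → lin₂ a (embed X) b (embed Y) ≡ embed (lin₂ a X b Y)
    lin₂-embed a (u ∷ s) b (v ∷ t) = trans (lin₂-++ a (u · Q) s b (v · Q) t)
      (cong (_++ lin₂ a s b t) (trans (cong₂ _⊕_ (·-assoc a u Q) (·-assoc b v Q)) (·-distribʳ (a * u) (b * v) Q)))

    embed≡0 : ∀ {n} (X : Vec Carrier (suc n)) → embed X ≡ zeroV → X ≡ zeroV
    embed≡0 (u ∷ t) e with ++≡0 (u · Q) e
    ... | uQ≡0 , t≡0 = cong₂ _∷_ (·≡0⇒a≡0 Q-nonzero uQ≡0) t≡0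

    embed-indep₂ : ∀ {n} {X Y : Vec Carrier (suc n)} → Indep₂ X Y → Indep₂ (embed X) (embed Y)
    embed-indep₂ {X = X} {Y} i a b e = i a b (embed≡0 _ (trans (sym (lin₂-embed a X b Y)) e))

    embed-indep₃ : ∀ {n} {X Y Z : Vec Carrier (suc n)} → Indep₃ X Y Z → Indep₃ (embed X) (embed Y) (embed Z)
    embed-indep₃ {X = X} {Y} {Z} i a b c e = i a b c (embed≡0 _ (begin
      embed (lin₂ a X b Y ⊕ (c · Z))
        ≡⟨ cong (λ W → embed (W ⊕ (c · Z))) (·-identity (lin₂ a X b Y)) ⟨
      embed (lin₂ 1# (lin₂ a X b Y) c Z)                   ≡⟨ lin₂-embed 1# (lin₂ a X b Y) c Z ⟨
      (1# · embed (lin₂ a X b Y)) ⊕ (c · embed Z)          ≡⟨ cong (_⊕ (c · embed Z)) (·-identity _) ⟩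
      embed (lin₂ a X b Y) ⊕ (c · embed Z)                 ≡⟨ cong (_⊕ (c · embed Z)) (lin₂-embed a X b Y) ⟨
      lin₃ a (embed X) b (embed Y) c (embed Z)             ≡⟨ e ⟩
      zeroV                                                ∎))
      where open ≡-Reasoning

    -- The first three coordinates relate only Q and P, which are independent; so the subspace
    -- spanned by Q and the last coordinates contains no `P ++ t`.
    mixed-indep : ∀ {n a b} (X : Vec Carrier (suc n)) {P t} → P ∈ K → (a · embed X) ⊕ (b · (P ++ t)) ≡ zeroV →
        a · X ≡ zeroV × b ≡ 0#
    mixed-indep {a = a} {b} (u ∷ s) {P} {t} P∈K e with lin₂-++≡0 (u · Q) P e
    ... | e₁ , e₂ with Q-indep P∈K (a * u) b (trans (cong (_⊕ (b · P)) (sym (·-assoc a u Q))) e₁)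
    ... | au≡0 , refl = cong₂ _∷_ au≡0 (trans (sym (lin₂-dropʳ t)) e₂) , refl

    mixed-indep₂ : ∀ {n} {X : Vec Carrier (suc n)} {P t} → X ≢ zeroV → P ∈ K → Indep₂ (embed X) (P ++ t)
    mixed-indep₂ {X = X} X≢0 P∈K a b e with mixed-indep X P∈K e
    ... | aX≡0 , b≡0 = ·≡0⇒a≡0 X≢0 aX≡0 , b≡0

    mixed-indep₃ : ∀ {n} {X Y : Vec Carrier (suc n)} {P t} → Indep₂ X Y → P ∈ K → Indep₃ (embed X) (embed Y) (P ++ t)
    mixed-indep₃ {X = X} {Y} {P} {t} i P∈K a b c e
      with mixed-indep {a = 1#} (lin₂ a X b Y) P∈K
             (trans (cong (_⊕ (c · (P ++ t))) (trans (·-identity _) (sym (lin₂-embed a X b Y)))) e)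
    ... | e₁ , c≡0 with i a b (trans (sym (·-identity _)) e₁)
    ... | a≡0 , b≡0 = a≡0 , b≡0 , c≡0

    module _ {j : ℕ} where

      fibre-indep₂ : ∀ {P} {x y : Vec Carrier j} → P ∈ K → x ≢ y → Indep₂ (P ++ enc x) (P ++ enc y)
      fibre-indep₂ {P} {x} {y} P∈K x≢y a b e with lin₂-++≡0 P P e
      ... | e₁ , e₂ with x+y≡0⇒x≡y (·≡0⇒a≡0 (nonzero P∈K) (trans (sym (·-distribʳ a b P)) e₁))
      ... | refl with a ≟ 0#
      ...   | yes a≡0  = a≡0 , a≡0
      ...   | no a≢0   = contradiction (enc-injective (·-cancel a≢0 (X⊕Y≡0⇒X≡Y e₂))) x≢y

      product-indep₂ : ∀ {P P′} {x y : Vec Carrier j} → P ∈ K → P′ ∈ K → P ++ enc x ≢ P′ ++ enc y →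
        Indep₂ (P ++ enc x) (P′ ++ enc y)
      product-indep₂ {P} {P′} P∈K P′∈K X≢Y with P ≟ᵛ P′
      ... | yes refl  = fibre-indep₂ P∈K (λ { refl → X≢Y refl })
      ... | no P≢P′   = λ a b e → indep₂ P∈K P′∈K P≢P′ a b (proj₁ (lin₂-++≡0 P P′ e))

      two-in-fibre-indep₃ : ∀ {P P′} {x y z : Vec Carrier j} → P ∈ K → P′ ∈ K → P ≢ P′ → x ≢ y →
        Indep₃ (P ++ enc x) (P ++ enc y) (P′ ++ enc z)
      two-in-fibre-indep₃ {P} {P′} P∈K P′∈K P≢P′ x≢y a b c e
        with indep₂ P∈K P′∈K P≢P′ (a + b) c
            (trans (cong (_⊕ (c · P′)) (sym (·-distribʳ a b P))) (proj₁ (lin₃-++≡0 P P P′ e)))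
      ... | _ , refl with fibre-indep₂ P∈K x≢y a b (trans (sym (lin₂-dropʳ _)) e)
      ... | a≡0 , b≡0 = a≡0 , b≡0 , refl

      -- The common P forces a + b + c = 0, whereupon `enc-collinear`, used twice, gives b c = 0 and
      -- a c = 0. Either c = 0 and two points remain, or a = b = 0 and the sum yields c = 0.
      fibre-indep₃ : ∀ {P} {x y z : Vec Carrier j} → P ∈ K → x ≢ y → x ≢ z → y ≢ z →
        Indep₃ (P ++ enc x) (P ++ enc y) (P ++ enc z)
      fibre-indep₃ {P} {x} {y} {z} P∈K x≢y x≢z y≢z a b c e with lin₃-++≡0 P P P e
      ... | e₁ , e₂ = conclude (c ≟ 0#)
        where
        a+b+c≡0 : a + b + c ≡ 0#
        a+b+c≡0 = ·≡0⇒a≡0 (nonzero P∈K)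
          (trans (sym (trans (cong (_⊕ (c · P)) (·-distribʳ a b P)) (·-distribʳ (a + b) c P))) e₁)

        bc≡0 : b * c ≡ 0#
        bc≡0 = enc-collinear x y z (x+y≡0⇒x≡y (trans (sym (+-assoc a b c)) a+b+c≡0)) e₂ y≢z

        ac≡0 : a * c ≡ 0#
        ac≡0 = enc-collinear y x z (x+y≡0⇒x≡y
            (trans (solve 3 (λ a b c → b :+ (a :+ c) := a :+ b :+ c) refl a b c) a+b+c≡0))
          (trans (cong (_⊕ _) (⊕-comm _ _)) e₂) x≢z

        conclude : Dec (c ≡ 0#) → a ≡ 0# × b ≡ 0# × c ≡ 0#
        conclude (yes refl) with fibre-indep₂ P∈K x≢y a b (trans (sym (lin₂-dropʳ _)) e)
        ... | a≡0 , b≡0 = a≡0 , b≡0 , refl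
        conclude (no c≢0) = a≡0 , b≡0 ,
          trans (sym (trans (cong₂ (λ a b → a + b + c) a≡0 b≡0)
              (trans (cong (_+ c) (+-identityˡ 0#)) (+-identityˡ c)))) a+b+c≡0
          where
          a≡0 = *-cancel-0 c≢0 (trans (*-comm c a) ac≡0)
          b≡0 = *-cancel-0 c≢0 (trans (*-comm c b) bc≡0)

      product-indep₃ : ∀ {P₁ P₂ P₃} {x y z : Vec Carrier j} → P₁ ∈ K → P₂ ∈ K → P₃ ∈ K →
        P₁ ++ enc x ≢ P₂ ++ enc y → P₁ ++ enc x ≢ P₃ ++ enc z → P₂ ++ enc y ≢ P₃ ++ enc z →
        Indep₃ (P₁ ++ enc x) (P₂ ++ enc y) (P₃ ++ enc z)
      product-indep₃ {P₁} {P₂} {P₃} P₁∈K P₂∈K P₃∈K X≢Y X≢Z Y≢Z with P₁ ≟ᵛ P₂ | P₁ ≟ᵛ P₃ | P₂ ≟ᵛ P₃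
      ... | yes refl | yes refl | _ =
        fibre-indep₃ P₁∈K (λ { refl → X≢Y refl }) (λ { refl → X≢Z refl }) (λ { refl → Y≢Z refl })
      ... | yes refl | no P₁≢P₃ | _ =
        two-in-fibre-indep₃ P₁∈K P₃∈K P₁≢P₃ (λ { refl → X≢Y refl })
      ... | no P₁≢P₂ | yes refl | _ =
        indep₃-swap₂₃ (two-in-fibre-indep₃ P₁∈K P₂∈K P₁≢P₂ (λ { refl → X≢Z refl }))
      ... | no P₁≢P₂ | no _ | yes refl =
        indep₃-swap₁₂ (indep₃-swap₂₃ (two-in-fibre-indep₃ P₂∈K P₁∈K (λ e → P₁≢P₂ (sym e)) (λ { refl → Y≢Z refl })))
      ... | no P₁≢P₂ | no P₁≢P₃ | no P₂≢P₃ =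
        λ a b c e → indep₃ P₁∈K P₂∈K P₃∈K P₁≢P₂ P₁≢P₃ P₂≢P₃ a b c (proj₁ (lin₃-++≡0 P₁ P₂ P₃ e))

      -- The origin of `Bad`. Suppose a ≠ 0 in a relation. If P = P′, then u Q is a multiple of P,
      -- so u = 0 and b = c. If P and P′ differ and u ≠ 0, then Q lies on their secant with
      -- coefficients b / (a u) and c / (a u), which agree by the sum-point property; if u = 0,
      -- independence of P and P′ kills b and c and leaves a · X = 0. In the surviving cases X is
      -- bad with κ = b / a.
      secant-indep₃ : ∀ {X P P′} {x y : Vec Carrier j} → X ≢ zeroV → ¬ Bad K Q j X → P ∈ K → P′ ∈ K →
        P ++ enc x ≢ P′ ++ enc y → Indep₃ (embed X) (P ++ enc x) (P′ ++ enc y)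
      secant-indep₃ {u ∷ t} {P} {P′} {x} {y} X≢0 ¬bad P∈K P′∈K Y≢Z a b c e
        with lin₃-++≡0 (u · Q) P P′ e | P ≟ᵛ P′
      ... | e₁ , e₂ | yes refl
        with Q-indep P∈K (a * u) (b + c)
            (trans (sym (trans (⊕-assoc _ _ _) (cong₂ _⊕_ (·-assoc a u Q) (·-distribʳ b c P)))) e₁)
      ... | au≡0 , b+c≡0 with x+y≡0⇒x≡y b+c≡0 | a ≟ 0#
      ... | refl | yes refl = refl , fibre-indep₂ P∈K (λ { refl → Y≢Z refl }) b b
              (trans (sym (trans (⊕-assoc _ _ _) (lin₂-dropˡ _))) e)
      ... | refl | no a≢0 with b ≟ 0#
      ...   | yes refl = contradiction
          (·≡0⇒a≡0 X≢0 (cong₂ _∷_ au≡0 (trans (sym (trans (lin₂-dropʳ (enc y)) (lin₂-dropʳ (enc x)))) e₂))) a≢0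
      ...   | no b≢0 = contradiction (b * inv a , *-≢0 b≢0 (inv≢0 a≢0) , enc-parabolic j t x y a≢0 e₂ ,
          inj₁ (*-cancel-0 a≢0 au≡0)) ¬bad
      secant-indep₃ {u ∷ t} {P} {P′} {x} {y} X≢0 ¬bad P∈K P′∈K Y≢Z a b c e | e₁ , e₂ | no P≢P′
        with (a * u) ≟ 0#
      ... | yes au≡0 with indep₂ P∈K P′∈K P≢P′ b c (trans (sym (trans (⊕-assoc _ _ _)
             (trans (cong (_⊕ lin₂ b P c P′) (trans (·-assoc a u Q) (cong (_· Q) au≡0))) (lin₂-dropˡ Q)))) e₁)
      ...   | refl , refl = ·≡0⇒a≡0 X≢0
          (cong₂ _∷_ au≡0 (trans (sym (trans (lin₂-dropʳ (enc y)) (lin₂-dropʳ (enc x)))) e₂)) , refl , refl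
      secant-indep₃ {u ∷ t} {P} {P′} {x} {y} X≢0 ¬bad P∈K P′∈K Y≢Z a b c e | e₁ , e₂ | no P≢P′
          | no au≢0 = bad b≡c
        where
        i = inv (a * u)
        a≢0 : a ≢ 0#
        a≢0 refl = au≢0 (zeroˡ u)

        Q≡ : Q ≡ lin₂ (i * b) P (i * c) P′
        Q≡ = trans (·-cancel-inv au≢0 (X⊕Y≡0⇒X≡Y
            (trans (cong (_⊕ lin₂ b P c P′) (sym (·-assoc a u Q))) (trans (sym (⊕-assoc _ _ _)) e₁))))
                (·-lin₂ i b P c P′)

        b≡c : b ≡ c
        b≡c = x+y≡0⇒x≡y (*-cancel-0 (inv≢0 au≢0) (trans (distribˡ i b c) (x≡y⇒x+y≡0 (Q-sum P∈K P′∈K P≢P′ Q≡))))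

        κ≡ : b * inv a ≡ (i * b) * u
        κ≡ = begin
          b * inv a                  ≡⟨ *-identityʳ _ ⟨
          b * inv a * 1#             ≡⟨ cong (b * inv a *_) (*-invʳ au≢0) ⟨
          b * inv a * (a * u * i)
            ≡⟨ solve 5 (λ b k a u i → b :* k :* (a :* u :* i) := (a :* k) :* ((i :* b) :* u)) refl b (inv a) a u i ⟩
          (a * inv a) * ((i * b) * u)  ≡⟨ cong (_* ((i * b) * u)) (*-invʳ a≢0) ⟩
          1# * ((i * b) * u)         ≡⟨ *-identityˡ _ ⟩
          (i * b) * u                ∎
          where open ≡-Reasoning

        bad : b ≡ c → a ≡ 0# × b ≡ 0# × c ≡ 0#
        bad refl with b ≟ 0#
        ... | yes refl = contradiction (trans Q≡
            (trans (cong₂ (λ k l → lin₂ k P l P′) (zeroʳ i) (zeroʳ i)) (trans (lin₂-dropˡ P) (·-zeroˡ P′)))) Q-nonzero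
        ... | no b≢0 = contradiction (b * inv a , *-≢0 b≢0 (inv≢0 a≢0) , enc-parabolic j t x y a≢0 e₂ ,
                inj₂ (i * b , (P , P′ , P∈K , P′∈K , P≢P′ , Q≡) , κ≡)) ¬bad

      private
        Ambient : Set
        Ambient = Vec Carrier (3 ℕ.+ double j)

      blow-up : List (Vec Carrier (suc (double j))) → List Ambient
      blow-up L = cartesianProductWith (λ P x → P ++ enc x) K (vectors j) List.++ map embed L

      ∈-blow-up⁻ : ∀ {L X} → X ∈ blow-up L →
        (∃[ P ] ∃[ x ] (P ∈ K × X ≡ P ++ enc x)) ⊎ (∃[ Y ] (Y ∈ L × X ≡ embed Y))
      ∈-blow-up⁻ X∈ with ∈-++⁻ (cartesianProductWith (λ P x → P ++ enc x) K (vectors j)) X∈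
      ... | inj₂ X∈W = inj₂ (∈-map⁻ embed X∈W)
      ... | inj₁ X∈A with ∈-cartesianProductWith⁻ (λ P x → P ++ enc x) K (vectors j) X∈A
      ...   | P , x , P∈K , _ , X≡ = inj₁ (P , x , P∈K , X≡)

      ∈-blow-up⁺ : ∀ L {P} x → P ∈ K → P ++ enc x ∈ blow-up L
      ∈-blow-up⁺ L x P∈K = ∈-++⁺ˡ (∈-cartesianProductWith⁺ (λ P x → P ++ enc x) P∈K (∈-vectors x))

      embed∈blow-up : ∀ {L X} → X ∈ L → embed X ∈ blow-up L
      embed∈blow-up X∈L = ∈-++⁺ʳ _ (∈-map⁺ embed X∈L)

      module _ {L : List (Vec Carrier (suc (double j)))}
               (avoidsL : ∀ {X} → X ∈ L → ¬ Bad K Q j X) where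
        -- By the number of points taken from L: with none, the product set is a cap; with one,
        -- avoidance applies; with two, the third point lies off the subspace; with three, L is a
        -- cap.
        blow-up-cap : ProjectiveCap L → ProjectiveCap (blow-up L)
        blow-up-cap capL = record { nonzero = nonzero′ ; indep₂ = indep₂′ ; indep₃ = indep₃′ }
          where
          module L = ProjectiveCap capL

          nonzero′ : ∀ {X} → X ∈ blow-up L → X ≢ zeroV
          nonzero′ X∈ e with ∈-blow-up⁻ X∈
          ... | inj₁ (P , x , P∈K , refl) = nonzero P∈K (proj₁ (++≡0 P e))
          ... | inj₂ (X , X∈L , refl) = L.nonzero X∈L (embed≡0 X e)

          indep₂′ : ∀ {X Y} → X ∈ blow-up L → Y ∈ blow-up L → X ≢ Y → Indep₂ X Y
          indep₂′ X∈ Y∈ X≢Y with ∈-blow-up⁻ X∈ | ∈-blow-up⁻ Y∈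
          ... | inj₁ (P , x , P∈K , refl) | inj₁ (P′ , y , P′∈K , refl) = product-indep₂ {x = x} {y} P∈K P′∈K X≢Y
          ... | inj₁ (P , x , P∈K , refl) | inj₂ (Y , Y∈L , refl) = indep₂-swap (mixed-indep₂ (L.nonzero Y∈L) P∈K)
          ... | inj₂ (X , X∈L , refl) | inj₁ (P , x , P∈K , refl) = mixed-indep₂ (L.nonzero X∈L) P∈K
          ... | inj₂ (X , X∈L , refl) | inj₂ (Y , Y∈L , refl) =
              embed-indep₂ (L.indep₂ X∈L Y∈L (λ { refl → X≢Y refl }))

          indep₃′ : ∀ {X Y Z} → X ∈ blow-up L → Y ∈ blow-up L → Z ∈ blow-up L → X ≢ Y → X ≢ Z → Y ≢ Z → Indep₃ X Y Z
          indep₃′ X∈ Y∈ Z∈ X≢Y X≢Z Y≢Z with ∈-blow-up⁻ X∈ | ∈-blow-up⁻ Y∈ | ∈-blow-up⁻ Z∈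
          ... | inj₁ (_ , x , P∈K , refl) | inj₁ (_ , y , P′∈K , refl) | inj₁ (_ , z , P″∈K , refl) =
            product-indep₃ {x = x} {y} {z} P∈K P′∈K P″∈K X≢Y X≢Z Y≢Z
          ... | inj₂ (_ , X∈L , refl) | inj₁ (_ , y , P∈K , refl) | inj₁ (_ , z , P′∈K , refl) =
            secant-indep₃ {x = y} {z} (L.nonzero X∈L) (avoidsL X∈L) P∈K P′∈K Y≢Z
          ... | inj₁ (_ , x , P∈K , refl) | inj₂ (_ , Y∈L , refl) | inj₁ (_ , z , P′∈K , refl) =
            indep₃-swap₁₂ (secant-indep₃ {x = x} {z} (L.nonzero Y∈L) (avoidsL Y∈L) P∈K P′∈K X≢Z)
          ... | inj₁ (_ , x , P∈K , refl) | inj₁ (_ , y , P′∈K , refl) | inj₂ (_ , Z∈L , refl) =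
            indep₃-swap₂₃ (indep₃-swap₁₂ (secant-indep₃ {x = x} {y} (L.nonzero Z∈L) (avoidsL Z∈L) P∈K P′∈K X≢Y))
          ... | inj₂ (_ , X∈L , refl) | inj₂ (_ , Y∈L , refl) | inj₁ (_ , z , P∈K , refl) =
            mixed-indep₃ (L.indep₂ X∈L Y∈L (λ { refl → X≢Y refl })) P∈K
          ... | inj₂ (_ , X∈L , refl) | inj₁ (_ , y , P∈K , refl) | inj₂ (_ , Z∈L , refl) =
            indep₃-swap₂₃ (mixed-indep₃ (L.indep₂ X∈L Z∈L (λ { refl → X≢Z refl })) P∈K)
          ... | inj₁ (_ , x , P∈K , refl) | inj₂ (_ , Y∈L , refl) | inj₂ (_ , Z∈L , refl) =
            indep₃-swap₁₂ (indep₃-swap₂₃ (mixed-indep₃ (L.indep₂ Y∈L Z∈L (λ { refl → Y≢Z refl })) P∈K))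
          ... | inj₂ (_ , X∈L , refl) | inj₂ (_ , Y∈L , refl) | inj₂ (_ , Z∈L , refl) =
            embed-indep₃ (L.indep₃ X∈L Y∈L Z∈L (λ { refl → X≢Y refl }) (λ { refl → X≢Z refl })
                (λ { refl → Y≢Z refl }))

        -- In `P ++ enc x` the first pair lies inside P, so badness restricts to the plane. In
        -- `embed (u ∷ t)` the first three coordinates are u · Q: if u ≠ 0, dividing κ by u makes Q
        -- bad, and if u = 0, the remaining pairs make `u ∷ t` bad one level down with the same κ.
        blow-up-avoids : ∀ {X} → X ∈ blow-up L → ¬ Bad K Q (suc j) X
        blow-up-avoids X∈ bad with ∈-blow-up⁻ X∈
        blow-up-avoids X∈ (κ , κ≢0 , (e , _) , h) | inj₁ (_ ∷ _ ∷ _ ∷ [] , x , P∈K , refl) =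
          avoids P∈K (κ , κ≢0 , (e , tt) , h)
        blow-up-avoids X∈ bad | inj₂ (u ∷ t , X∈L , refl) = embed-avoids Q u refl bad
          where
          -- The equation lets the parameter `Q` be taken apart into its three coordinates.
          embed-avoids : ∀ Q′ u′ → (Q′ , u′) ≡ (Q , u) → ¬ Bad K Q (suc j) ((u′ · Q′) ++ t)
          embed-avoids (q₀ ∷ q₁ ∷ q₂ ∷ []) _ refl (κ , κ≢0 , (e , par) , h) with u ≟ 0#
          ... | yes u≡0 = avoidsL X∈L (κ , κ≢0 , par , inj₁ u≡0)
          ... | no u≢0 = Q-avoids (inv u * κ , *-≢0 (inv≢0 u≢0) κ≢0 , (cancel , tt) , side h)
            where
            open ≡-Reasoning
            cancel : inv u * κ * q₂ ≡ q₁ * q₁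
            cancel = begin
              inv u * κ * q₂                              ≡⟨ *-identityˡ _ ⟨
              1# * (inv u * κ * q₂)                       ≡⟨ cong (_* (inv u * κ * q₂)) (*-invʳ u≢0) ⟨
              u * inv u * (inv u * κ * q₂)
                ≡⟨ solve 4 (λ u i k q → u :* i :* (i :* k :* q) := i :* i :* (k :* (u :* q))) refl u (inv u) κ q₂ ⟩
              inv u * inv u * (κ * (u * q₂))              ≡⟨ cong (inv u * inv u *_) e ⟩
              inv u * inv u * ((u * q₁) * (u * q₁))
                ≡⟨ solve 3 (λ u i q → i :* i :* ((u :* q) :* (u :* q)) := (u :* i) :* (u :* i) :* (q :* q)) refl
                    u (inv u) q₁ ⟩
              (u * inv u) * (u * inv u) * (q₁ * q₁)       ≡⟨ cong (λ k → k * k * (q₁ * q₁)) (*-invʳ u≢0) ⟩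
              1# * 1# * (q₁ * q₁)
                ≡⟨ solve 1 (λ q → con true :* con true :* q := q) refl (q₁ * q₁) ⟩
              q₁ * q₁                                     ∎
            side : (u * q₀ ≡ 0# ⊎ ∃[ c ] (SecantCoefficient K Q c × κ ≡ c * (u * q₀))) →
                   (q₀ ≡ 0# ⊎ ∃[ c ] (SecantCoefficient K Q c × inv u * κ ≡ c * q₀))
            side (inj₁ uq₀≡0) = inj₁ (*-cancel-0 u≢0 uq₀≡0)
            side (inj₂ (c , sc , refl)) = inj₂ (c , sc , (begin
              inv u * (c * (u * q₀))
                ≡⟨ solve 4 (λ i c u q → i :* (c :* (u :* q)) := (u :* i) :* (c :* q)) refl (inv u) c u q₀ ⟩
              (u * inv u) * (c * q₀)   ≡⟨ cong (_* (c * q₀)) (*-invʳ u≢0) ⟩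
              1# * (c * q₀)            ≡⟨ *-identityˡ _ ⟩
              c * q₀                   ∎))

      blow-up-covers : ∀ {L : List (Vec Carrier (suc (double j)))} → Covers L → Covers (blow-up L)
      blow-up-covers {L} coversL (x₀ ∷ x₁ ∷ x₂ ∷ t) with split (x₀ ∷ x₁ ∷ x₂ ∷ [])
      ... | inj₁ (u , e) with coversL (u ∷ t)
      ...   | Y , Z , Y∈L , Z∈L , α , β , X≡ = embed Y , embed Z , embed∈blow-up Y∈L , embed∈blow-up Z∈L , α , β ,
        trans (cong (_++ t) e) (trans (cong embed X≡) (sym (lin₂-embed α Y β Z)))
      blow-up-covers {L} coversL (x₀ ∷ x₁ ∷ x₂ ∷ t)
          | inj₂ (P₁ , P₂ , c₁ , c₂ , P₁∈K , P₂∈K , c₁≢0 , c₂≢0 , c₁≢c₂ , e) with enc-cover c₁≢0 c₂≢0 c₁≢c₂ j t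
      ... | x , y , t≡ = P₁ ++ enc x , P₂ ++ enc y , ∈-blow-up⁺ L x P₁∈K , ∈-blow-up⁺ L y P₂∈K , c₁ , c₂ ,
        trans (cong₂ _++_ e t≡) (sym (lin₂-++ c₁ P₁ (enc x) c₂ P₂ (enc y)))

      length-blow-up : ∀ L → length (blow-up L) ≡ length K ℕ.* order ℕ.^ j ℕ.+ length L
      length-blow-up L = trans (length-++ (cartesianProductWith (λ P x → P ++ enc x) K (vectors j)))
        (cong₂ ℕ._+_ (trans (length-cartesianProductWith _ K (vectors j))
            (cong (length K ℕ.*_) (length-vectors j))) (length-map embed L))

    -- Indexed so that `tower j` lies in projective dimension 2j + 2, with the planar cap at the
    -- bottom. Each step from `tower j` adds one product set of size |K| q^(j+1), whence the
    -- geometric sum.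
    tower : ∀ j → List (Vec Carrier (suc (double (suc j))))
    tower zero     = K
    tower (suc j)  = blow-up (tower j)

    -- The cap property of a level uses avoidance one level below, so one induction carries both.
    tower-cap×avoids : ∀ j → ProjectiveCap (tower j) × (∀ {X} → X ∈ tower j → ¬ Bad K Q (suc j) X)
    tower-cap×avoids zero = cap , avoids
    tower-cap×avoids (suc j) with tower-cap×avoids j
    ... | capL , avoidsL = blow-up-cap avoidsL capL , blow-up-avoids avoidsL

    tower-covers : ∀ j → Covers (tower j)
    tower-covers zero     = covers
    tower-covers (suc j)  = blow-up-covers (tower-covers j)

    length-tower : ∀ j → length (tower j) ≡ length K ℕ.* geomSum order j
    length-tower zero     = sym (ℕ.*-identityʳ (length K))
    length-tower (suc j)  = begin
      length (blow-up (tower j))                                        ≡⟨ length-blow-up (tower j) ⟩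
      length K ℕ.* order ℕ.^ suc j ℕ.+ length (tower j)
        ≡⟨ cong (length K ℕ.* order ℕ.^ suc j ℕ.+_) (length-tower j) ⟩
      length K ℕ.* order ℕ.^ suc j ℕ.+ length K ℕ.* geomSum order j     ≡⟨ ℕ.*-distribˡ-+ (length K) _ _ ⟨
      length K ℕ.* geomSum order (suc j)                                ∎
      where open ≡-Reasoning

    tower-completeCap : ∀ j → ∃[ C ] (CompleteCap {double (suc j)} C × length C ℕ.≤ length K ℕ.* geomSum order j)
    tower-completeCap j = normalisation , (normalisation-cap , normalisation-complete (tower-covers j)) ,
      ℕ.≤-trans length-normalisation (ℕ.≤-reflexive (length-tower j))
      where open Normalisation (tower j) (proj₁ (tower-cap×avoids j))

  -- Planar complete caps with a unique sum-point

  off-secant⇒indep₃ : ∀ {N} {X Y Z : Vector N} → Indep₂ Y Z → ¬ OnSecant X Y Z → Indep₃ X Y Z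
  off-secant⇒indep₃ {X = X} {Y} {Z} i ¬on a b c e with a ≟ 0#
  ... | yes refl = refl , i b c (trans (sym (trans (⊕-assoc _ _ _) (lin₂-dropˡ X))) e)
  ... | no a≢0   = contradiction (inv a * b , inv a * c ,
    trans (·-cancel-inv a≢0 (X⊕Y≡0⇒X≡Y (trans (sym (⊕-assoc _ _ _)) e))) (·-lin₂ (inv a) b Y c Z)) ¬on

  indep₃⇒¬collinear : ∀ {N} {X Y Z : Vector N} → Indep₃ X Y Z → ¬ Collinear X Y Z
  indep₃⇒¬collinear i (a , b , c , ¬zero , e) = ¬zero (i a b c e)

  module _ {N} {K : List (Vector N)} (K-complete : CompleteCap K) where
    open ProjectiveCap (cap⇒projectiveCap (proj₁ K-complete))
    open import Data.List.Membership.DecPropositional (_≟ᵛ_ {suc N}) using (_∈?_)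

    -- Completeness is a negative statement, but the search through pairs of K is decidable: were it
    -- to fail, every triple containing X would be independent and `X ∷ K` would be a cap.
    secant-through : ∀ {X} → Normalized X → X ∉ K → ∃[ Y ] ∃[ Z ] (Y ∈ K × Z ∈ K × Y ≢ Z × OnSecant X Y Z)
    secant-through {X} nX X∉K with any? (λ Y → any? (λ Z → ¬? (Y ≟ᵛ Z) ×-dec onSecant? X Y Z) K) K
    ... | yes p with find p
    ...   | Y , Y∈K , q with find q
    ...     | Z , Z∈K , Y≢Z , on = Y , Z , Y∈K , Z∈K , Y≢Z , on
    secant-through {X} nX X∉K | no ¬p = contradiction extended (proj₂ K-complete X nX X∉K)
      where
      X-indep : ∀ {Y Z} → Y ∈ K → Z ∈ K → Y ≢ Z → Indep₃ X Y Z
      X-indep Y∈K Z∈K Y≢Z = off-secant⇒indep₃ (indep₂ Y∈K Z∈K Y≢Z) (λ on → ¬p (lose Y∈K (lose Z∈K (Y≢Z , on))))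

      noncollinear : ∀ {P Q R} → P ∈ X ∷ K → Q ∈ X ∷ K → R ∈ X ∷ K → P ≢ Q → P ≢ R → Q ≢ R → ¬ Collinear P Q R
      noncollinear (here refl) (here refl) _ P≢Q _ _ = contradiction refl P≢Q
      noncollinear (here refl) _ (here refl) _ P≢R _ = contradiction refl P≢R
      noncollinear _ (here refl) (here refl) _ _ Q≢R = contradiction refl Q≢R
      noncollinear (here refl) (there Q∈) (there R∈) _ _ Q≢R = indep₃⇒¬collinear (X-indep Q∈ R∈ Q≢R)
      noncollinear (there P∈) (here refl) (there R∈) _ P≢R _ = indep₃⇒¬collinear (indep₃-swap₁₂ (X-indep P∈ R∈ P≢R))
      noncollinear (there P∈) (there Q∈) (here refl) P≢Q _ _ =
        indep₃⇒¬collinear (indep₃-swap₂₃ (indep₃-swap₁₂ (X-indep P∈ Q∈ P≢Q)))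
      noncollinear (there P∈) (there Q∈) (there R∈) P≢Q P≢R Q≢R =
        indep₃⇒¬collinear (indep₃ P∈ Q∈ R∈ P≢Q P≢R Q≢R)

      extended : Cap (X ∷ K)
      extended = All.tabulate (λ Y∈K X≡Y → X∉K (subst (_∈ K) (sym X≡Y) Y∈K)) ∷ proj₁ (proj₁ K-complete) ,
        nX ∷ proj₁ (proj₂ (proj₁ K-complete)) , noncollinear

    -- The point `P` serves to represent the zero vector, which `Covers` includes.
    completeCap-covers : ∀ {P} → P ∈ K → Covers K
    completeCap-covers {P} P∈K X with X ≟ᵛ zeroV
    ... | yes refl = P , P , P∈K , P∈K , 0# , 0# , sym (trans (lin₂-dropˡ P) (·-zeroˡ P))
    ... | no X≢0 with normalise X X≢0
    ...   | s , s≢0 , nX with (s · X) ∈? K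
    ...     | yes X∈K = s · X , s · X , X∈K , X∈K , inv s , 0# ,
        trans (·-cancel-inv s≢0 refl) (sym (lin₂-dropʳ (s · X)))
    ...     | no X∉K with secant-through nX X∉K
    ...       | Y , Z , Y∈K , Z∈K , _ , α , β , e = Y , Z , Y∈K , Z∈K , inv s * α , inv s * β ,
      trans (·-cancel-inv s≢0 e) (·-lin₂ (inv s) α Y β Z)

  module _ {K : List (Vector 2)} {Q : Vector 2} (2<order : 2 ℕ.< order)
           (K-complete : CompleteCap K) (Q-unique : UniqueSumPoint K Q) where
    open ProjectiveCap (cap⇒projectiveCap (proj₁ K-complete))
    open import Data.List.Membership.DecPropositional (_≟ᵛ_ {3}) using (_∈?_)
    private
      normalized : ∀ {P} → P ∈ K → Normalized P
      normalized = All.lookup (proj₁ (proj₂ (proj₁ K-complete)))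

      nQ = proj₁ (proj₁ Q-unique)
      Q∉K = proj₁ (proj₂ (proj₁ Q-unique))

      UnequalSecant : Vector 2 → Set
      UnequalSecant v = ∃[ P₁ ] ∃[ P₂ ] ∃[ c₁ ] ∃[ c₂ ]
        (P₁ ∈ K × P₂ ∈ K × c₁ ≢ 0# × c₂ ≢ 0# × c₁ ≢ c₂ × v ≡ lin₂ c₁ P₁ c₂ P₂)

    -- By uniqueness of Q, the point X is not a sum-point, so a finite search finds a secant with
    -- unequal coefficients. Neither vanishes, since X would then be a point of K.
    unequal-secant : ∀ {X} → Normalized X → X ∉ K → X ≢ Q → UnequalSecant X
    unequal-secant {X} nX X∉K X≢Q
      with any? (λ P₁ → any? (λ P₂ → ¬? (P₁ ≟ᵛ P₂) ×-dec any?
          (λ c₁ → any? (λ c₂ → ¬? (c₁ ≟ c₂) ×-dec (X ≟ᵛ lin₂ c₁ P₁ c₂ P₂)) elements) elements) K) K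
    ... | no ¬p = contradiction (proj₂ Q-unique X (nX , X∉K , λ {P₁} {P₂} P₁∈K P₂∈K P₁≢P₂ c₁ c₂ e →
      decidable-stable (c₁ ≟ c₂) (λ c₁≢c₂ →
          ¬p (lose P₁∈K (lose P₂∈K (P₁≢P₂ , lose (complete c₁) (lose (complete c₂) (c₁≢c₂ , e)))))))) X≢Q
    ... | yes p with find p
    ... | P₁ , P₁∈K , p₁ with find p₁
    ... | P₂ , P₂∈K , P₁≢P₂ , p₂ with find p₂
    ... | c₁ , _ , p₃ with find p₃
    ... | c₂ , _ , c₁≢c₂ , e = P₁ , P₂ , c₁ , c₂ , P₁∈K , P₂∈K ,
      (λ { refl → not-proportional P₂∈K (trans e (lin₂-dropˡ P₁)) }) ,
      (λ { refl → not-proportional P₁∈K (trans e (lin₂-dropʳ P₂)) }) , c₁≢c₂ , e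
      where
      not-proportional : ∀ {P c} → P ∈ K → X ≢ c · P
      not-proportional P∈K e = X∉K (subst (_∈ K) (sym (normalized-proportional nX (normalized P∈K) e)) P∈K)

    sumPoint-split : ∀ v → (∃[ u ] v ≡ u · Q) ⊎ UnequalSecant v
    sumPoint-split v with v ≟ᵛ zeroV
    ... | yes refl = inj₁ (0# , sym (·-zeroˡ Q))
    ... | no v≢0 with normalise v v≢0
    ... | s , s≢0 , nX with (s · v) ≟ᵛ Q | (s · v) ∈? K
    ... | yes e | _ = inj₁ (inv s , ·-cancel-inv s≢0 e)
    ... | no X≢Q | no X∉K with unequal-secant nX X∉K X≢Q
    ...   | P₁ , P₂ , c₁ , c₂ , P₁∈K , P₂∈K , c₁≢0 , c₂≢0 , c₁≢c₂ , e =
      inj₂ (P₁ , P₂ , inv s * c₁ , inv s * c₂ , P₁∈K , P₂∈K , *-≢0 (inv≢0 s≢0) c₁≢0 , *-≢0 (inv≢0 s≢0) c₂≢0 ,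
        (λ e′ → c₁≢c₂ (x+y≡0⇒x≡y (*-cancel-0 (inv≢0 s≢0) (trans (distribˡ (inv s) c₁ c₂) (x≡y⇒x+y≡0 e′))))) ,
        trans (·-cancel-inv s≢0 e) (·-lin₂ (inv s) c₁ P₁ c₂ P₂))
    sumPoint-split v | no v≢0 | s , s≢0 , nX | no X≢Q | yes X∈K
      -- A multiple of a point of K is split over that same point as 1/s = α + (1/s + α). Both parts
      -- are nonzero when α avoids 0 and 1/s, which requires more than two elements; they differ
      -- because 1/s ≠ 0.
      with ∃-fresh _≟_ {ys = 0# ∷ inv s ∷ []} distinct 2<order
    ... | α , _ , α∉ = inj₂ (s · v , s · v , α , inv s + α , X∈K , X∈K ,
        (λ { refl → α∉ (here refl) }) ,
        (λ e → α∉ (there (here (sym (x+y≡0⇒x≡y e))))) ,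
        (λ e → inv≢0 s≢0 (trans (solve 2 (λ a i → i := a :+ (i :+ a)) refl α (inv s)) (x≡y⇒x+y≡0 e))) ,
        trans (·-cancel-inv s≢0 refl) (trans
            (cong (_· (s · v)) (solve 2 (λ a i → i := a :+ (i :+ a)) refl α (inv s)))
                (sym (·-distribʳ α (inv s + α) (s · v)))))

    completeCap⇒sumPointCap : SumPointCap K Q
    completeCap⇒sumPointCap = record
      { cap        = cap⇒projectiveCap (proj₁ K-complete)
      ; covers     = completeCap-covers K-complete (proj₁ (proj₂ (proj₂ (secant-through K-complete nQ Q∉K))))
      ; Q-indep    = λ P∈K → normalized-indep₂ nQ (normalized P∈K) (λ { refl → Q∉K P∈K })
      ; Q-nonzero  = normalized⇒≢0 nQ
      ; Q-sum      = λ P₁∈K P₂∈K P₁≢P₂ → proj₂ (proj₂ (proj₁ Q-unique)) P₁∈K P₂∈K P₁≢P₂ _ _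
      ; split      = sumPoint-split
      }

  -- Transport of sum-point caps along linear isomorphisms.

  record LinearIso : Set where
    field
      to       : Vec Carrier 3 → Vec Carrier 3
      ⊕-homo   : ∀ X Y → to (X ⊕ Y) ≡ to X ⊕ to Y
      ·-homo   : ∀ a X → to (a · X) ≡ a · to X
      kernel   : ∀ {X} → to X ≡ zeroV → X ≡ zeroV
      onto     : ∀ Y → ∃[ X ] to X ≡ Y

  module Transfer (M : LinearIso) where
    open LinearIso M

    lin₂-homo : ∀ a X b Y → to (lin₂ a X b Y) ≡ lin₂ a (to X) b (to Y)
    lin₂-homo a X b Y = trans (⊕-homo _ _) (cong₂ _⊕_ (·-homo a X) (·-homo b Y))

    to-injective : ∀ {X Y} → to X ≡ to Y → X ≡ Y
    to-injective {X} {Y} e = X⊕Y≡0⇒X≡Y (kernel (trans (⊕-homo X Y) (X≡Y⇒X⊕Y≡0 e)))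

    to-indep₂ : ∀ {X Y} → Indep₂ X Y → Indep₂ (to X) (to Y)
    to-indep₂ {X} {Y} i a b e = i a b (kernel (trans (lin₂-homo a X b Y) e))

    to-indep₃ : ∀ {X Y Z} → Indep₃ X Y Z → Indep₃ (to X) (to Y) (to Z)
    to-indep₃ {X} {Y} {Z} i a b c e =
        i a b c (kernel (trans (trans (⊕-homo _ _) (cong₂ _⊕_ (lin₂-homo a X b Y) (·-homo c Z))) e))

    -- Linear maps keep coefficients, so the count of secants made in the original coordinates still
    -- bounds them after the change.
    secantCoefficient⁻ : ∀ {K Q c} → SecantCoefficient (map to K) (to Q) c → SecantCoefficient K Q c
    secantCoefficient⁻ {c = c} (_ , _ , P₁∈ , P₂∈ , P₁≢P₂ , e) with ∈-map⁻ to P₁∈ | ∈-map⁻ to P₂∈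
    ... | P₁ , P₁∈K , refl | P₂ , P₂∈K , refl =
      P₁ , P₂ , P₁∈K , P₂∈K , (λ { refl → P₁≢P₂ refl }) , to-injective (trans e (sym (lin₂-homo c P₁ c P₂)))

    transfer : ∀ {K Q} → SumPointCap K Q → SumPointCap (map to K) (to Q)
    transfer {K} {Q} S = record
      { cap        = record { nonzero = nonzero′ ; indep₂ = indep₂′ ; indep₃ = indep₃′ }
      ; covers     = covers′
      ; Q-indep    = Q-indep′
      ; Q-nonzero  = λ e → Q-nonzero (kernel e)
      ; Q-sum      = Q-sum′
      ; split      = split′
      }
      where
      open SumPointCap S
      open ProjectiveCap cap

      nonzero′ : ∀ {X} → X ∈ map to K → X ≢ zeroV
      nonzero′ X∈ e with ∈-map⁻ to X∈
      ... | _ , X∈K , refl = nonzero X∈K (kernel e)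

      indep₂′ : ∀ {X Y} → X ∈ map to K → Y ∈ map to K → X ≢ Y → Indep₂ X Y
      indep₂′ X∈ Y∈ X≢Y with ∈-map⁻ to X∈ | ∈-map⁻ to Y∈
      ... | _ , X∈K , refl | _ , Y∈K , refl = to-indep₂ (indep₂ X∈K Y∈K (λ { refl → X≢Y refl }))

      indep₃′ : ∀ {X Y Z} → X ∈ map to K → Y ∈ map to K → Z ∈ map to K → X ≢ Y → X ≢ Z → Y ≢ Z → Indep₃ X Y Z
      indep₃′ X∈ Y∈ Z∈ X≢Y X≢Z Y≢Z with ∈-map⁻ to X∈ | ∈-map⁻ to Y∈ | ∈-map⁻ to Z∈
      ... | _ , X∈K , refl | _ , Y∈K , refl | _ , Z∈K , refl =
        to-indep₃ (indep₃ X∈K Y∈K Z∈K (λ { refl → X≢Y refl }) (λ { refl → X≢Z refl }) (λ { refl → Y≢Z refl }))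

      covers′ : Covers (map to K)
      covers′ X with onto X
      ... | X₀ , refl with covers X₀
      ... | Y , Z , Y∈K , Z∈K , α , β , refl = to Y , to Z , ∈-map⁺ to Y∈K , ∈-map⁺ to Z∈K , α , β , lin₂-homo α Y β Z

      Q-indep′ : ∀ {P} → P ∈ map to K → Indep₂ (to Q) P
      Q-indep′ P∈ with ∈-map⁻ to P∈
      ... | _ , P∈K , refl = to-indep₂ (Q-indep P∈K)

      Q-sum′ : ∀ {P₁ P₂ c₁ c₂} → P₁ ∈ map to K → P₂ ∈ map to K → P₁ ≢ P₂ → to Q ≡ lin₂ c₁ P₁ c₂ P₂ → c₁ ≡ c₂
      Q-sum′ {c₁ = c₁} {c₂} P₁∈ P₂∈ P₁≢P₂ e with ∈-map⁻ to P₁∈ | ∈-map⁻ to P₂∈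
      ... | P₁ , P₁∈K , refl | P₂ , P₂∈K , refl =
        Q-sum P₁∈K P₂∈K (λ { refl → P₁≢P₂ refl }) (to-injective (trans e (sym (lin₂-homo c₁ P₁ c₂ P₂))))

      split′ : ∀ v → (∃[ u ] v ≡ u · to Q) ⊎
        (∃[ P₁ ] ∃[ P₂ ] ∃[ c₁ ] ∃[ c₂ ]
            (P₁ ∈ map to K × P₂ ∈ map to K × c₁ ≢ 0# × c₂ ≢ 0# × c₁ ≢ c₂ × v ≡ lin₂ c₁ P₁ c₂ P₂))
      split′ v with onto v
      ... | v₀ , refl with split v₀
      ... | inj₁ (u , refl) = inj₁ (u , ·-homo u Q)
      ... | inj₂ (P₁ , P₂ , c₁ , c₂ , P₁∈K , P₂∈K , c₁≢0 , c₂≢0 , c₁≢c₂ , refl) =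
        inj₂ (to P₁ , to P₂ , c₁ , c₂ , ∈-map⁺ to P₁∈K , ∈-map⁺ to P₂∈K , c₁≢0 , c₂≢0 , c₁≢c₂ , lin₂-homo c₁ P₁ c₂ P₂)

  -- Coordinates adapted to the sum-point

  private
    F³ : Set
    F³ = Vec Carrier 3

  xy+yx≡0 : ∀ x y → x * y + y * x ≡ 0#
  xy+yx≡0 = solve 2 (λ x y → x :* y :+ y :* x := con false) refl

  dot : F³ → F³ → Carrier
  dot (x₀ ∷ x₁ ∷ x₂ ∷ []) (y₀ ∷ y₁ ∷ y₂ ∷ []) = x₀ * y₀ + x₁ * y₁ + x₂ * y₂

  -- The vector product; its signs disappear in characteristic 2, so it is symmetric.
  cross : F³ → F³ → F³
  cross (x₀ ∷ x₁ ∷ x₂ ∷ []) (y₀ ∷ y₁ ∷ y₂ ∷ []) =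
    x₁ * y₂ + x₂ * y₁ ∷ x₂ * y₀ + x₀ * y₂ ∷ x₀ * y₁ + x₁ * y₀ ∷ []

  dot-⊕ : ∀ X Y Z → dot (X ⊕ Y) Z ≡ dot X Z + dot Y Z
  dot-⊕ (x₀ ∷ x₁ ∷ x₂ ∷ []) (y₀ ∷ y₁ ∷ y₂ ∷ []) (z₀ ∷ z₁ ∷ z₂ ∷ []) =
    solve 9 (λ x₀ x₁ x₂ y₀ y₁ y₂ z₀ z₁ z₂ →
      (x₀ :+ y₀) :* z₀ :+ (x₁ :+ y₁) :* z₁ :+ (x₂ :+ y₂) :* z₂
      := (x₀ :* z₀ :+ x₁ :* z₁ :+ x₂ :* z₂) :+ (y₀ :* z₀ :+ y₁ :* z₁ :+ y₂ :* z₂))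
      refl x₀ x₁ x₂ y₀ y₁ y₂ z₀ z₁ z₂

  dot-· : ∀ a X Z → dot (a · X) Z ≡ a * dot X Z
  dot-· a (x₀ ∷ x₁ ∷ x₂ ∷ []) (z₀ ∷ z₁ ∷ z₂ ∷ []) =
    solve 7 (λ a x₀ x₁ x₂ z₀ z₁ z₂ →
      a :* x₀ :* z₀ :+ a :* x₁ :* z₁ :+ a :* x₂ :* z₂ := a :* (x₀ :* z₀ :+ x₁ :* z₁ :+ x₂ :* z₂))
      refl a x₀ x₁ x₂ z₀ z₁ z₂

  dot-crossˡ : ∀ X Y → dot X (cross X Y) ≡ 0#
  dot-crossˡ (x₀ ∷ x₁ ∷ x₂ ∷ []) (y₀ ∷ y₁ ∷ y₂ ∷ []) =
    solve 6 (λ x₀ x₁ x₂ y₀ y₁ y₂ → x₀ :* (x₁ :* y₂ :+ x₂ :* y₁) :+ x₁ :* (x₂ :* y₀ :+ x₀ :* y₂) :+ x₂ :*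
        (x₀ :* y₁ :+ x₁ :* y₀) := con false)
      refl x₀ x₁ x₂ y₀ y₁ y₂

  dot-crossʳ : ∀ X Y → dot Y (cross X Y) ≡ 0#
  dot-crossʳ (x₀ ∷ x₁ ∷ x₂ ∷ []) (y₀ ∷ y₁ ∷ y₂ ∷ []) =
    solve 6 (λ x₀ x₁ x₂ y₀ y₁ y₂ → y₀ :* (x₁ :* y₂ :+ x₂ :* y₁) :+ y₁ :* (x₂ :* y₀ :+ x₀ :* y₂) :+ y₂ :*
        (x₀ :* y₁ :+ x₁ :* y₀) := con false)
      refl x₀ x₁ x₂ y₀ y₁ y₂

  dot-cross-swap : ∀ X Y Z → dot X (cross Y Z) ≡ dot Y (cross X Z)
  dot-cross-swap (x₀ ∷ x₁ ∷ x₂ ∷ []) (y₀ ∷ y₁ ∷ y₂ ∷ []) (z₀ ∷ z₁ ∷ z₂ ∷ []) =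
    solve 9 (λ x₀ x₁ x₂ y₀ y₁ y₂ z₀ z₁ z₂ →
      x₀ :* (y₁ :* z₂ :+ y₂ :* z₁) :+ x₁ :* (y₂ :* z₀ :+ y₀ :* z₂) :+ x₂ :* (y₀ :* z₁ :+ y₁ :* z₀)
      := y₀ :* (x₁ :* z₂ :+ x₂ :* z₁) :+ y₁ :* (x₂ :* z₀ :+ x₀ :* z₂) :+ y₂ :* (x₀ :* z₁ :+ x₁ :* z₀))
      refl x₀ x₁ x₂ y₀ y₁ y₂ z₀ z₁ z₂

  cross-comm : ∀ X Y → cross X Y ≡ cross Y X
  cross-comm (x₀ ∷ x₁ ∷ x₂ ∷ []) (y₀ ∷ y₁ ∷ y₂ ∷ []) =
      cong₂ _∷_ (flip x₁ y₂ x₂ y₁) (cong₂ _∷_ (flip x₂ y₀ x₀ y₂) (cong (_∷ []) (flip x₀ y₁ x₁ y₀)))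
    where
    flip : ∀ a b c d → a * b + c * d ≡ d * c + b * a
    flip = solve 4 (λ a b c d → a :* b :+ c :* d := d :* c :+ b :* a) refl

  cross-self : ∀ X → cross X X ≡ zeroV
  cross-self (x ∷ y ∷ z ∷ []) = cong₂ _∷_ (xy+yx≡0 y z) (cong₂ _∷_ (xy+yx≡0 z x) (cong (_∷ []) (xy+yx≡0 x y)))

  -- Cramer's rule without signs. The three coordinates are cyclic rotations of one polynomial
  -- identity, so the solver is called for the first only.
  cramer : ∀ X Y Z R → lin₃ (dot R (cross Y Z)) X (dot R (cross X Z)) Y (dot R (cross X Y)) Z ≡ dot X (cross Y Z) · R
  cramer (x₀ ∷ x₁ ∷ x₂ ∷ []) (y₀ ∷ y₁ ∷ y₂ ∷ []) (z₀ ∷ z₁ ∷ z₂ ∷ []) (r₀ ∷ r₁ ∷ r₂ ∷ []) =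
    cong₂ _∷_ (coordinate x₀ x₁ x₂ y₀ y₁ y₂ z₀ z₁ z₂ r₀ r₁ r₂)
      (cong₂ _∷_ (trans (cong₂ _+_ (cong₂ _+_ (cong (_* x₁) rot) (cong (_* y₁) rot)) (cong (_* z₁) rot))
                    (trans (coordinate x₁ x₂ x₀ y₁ y₂ y₀ z₁ z₂ z₀ r₁ r₂ r₀) (cong (_* r₁) (sym rot))))
        (cong (_∷ []) (trans (cong₂ _+_ (cong₂ _+_ (cong (_* x₂) rot′) (cong (_* y₂) rot′)) (cong (_* z₂) rot′))
                    (trans (coordinate x₂ x₀ x₁ y₂ y₀ y₁ z₂ z₀ z₁ r₂ r₀ r₁) (cong (_* r₂) (sym rot′))))))
    where
    rot : ∀ {a b c} → a + b + c ≡ b + c + a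
    rot {a} {b} {c} = trans (+-assoc a b c) (+-comm a (b + c))
    rot′ : ∀ {a b c} → a + b + c ≡ c + a + b
    rot′ = trans rot rot
    coordinate : ∀ x₀ x₁ x₂ y₀ y₁ y₂ z₀ z₁ z₂ r₀ r₁ r₂ →
      (r₀ * (y₁ * z₂ + y₂ * z₁) + r₁ * (y₂ * z₀ + y₀ * z₂) + r₂ * (y₀ * z₁ + y₁ * z₀)) * x₀ +
      (r₀ * (x₁ * z₂ + x₂ * z₁) + r₁ * (x₂ * z₀ + x₀ * z₂) + r₂ * (x₀ * z₁ + x₁ * z₀)) * y₀ +
      (r₀ * (x₁ * y₂ + x₂ * y₁) + r₁ * (x₂ * y₀ + x₀ * y₂) + r₂ * (x₀ * y₁ + x₁ * y₀)) * z₀ ≡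
      (x₀ * (y₁ * z₂ + y₂ * z₁) + x₁ * (y₂ * z₀ + y₀ * z₂) + x₂ * (y₀ * z₁ + y₁ * z₀)) * r₀
    coordinate = solve 12 (λ x₀ x₁ x₂ y₀ y₁ y₂ z₀ z₁ z₂ r₀ r₁ r₂ →
      (r₀ :* (y₁ :* z₂ :+ y₂ :* z₁) :+ r₁ :* (y₂ :* z₀ :+ y₀ :* z₂) :+ r₂ :* (y₀ :* z₁ :+ y₁ :* z₀)) :* x₀ :+
      (r₀ :* (x₁ :* z₂ :+ x₂ :* z₁) :+ r₁ :* (x₂ :* z₀ :+ x₀ :* z₂) :+ r₂ :* (x₀ :* z₁ :+ x₁ :* z₀)) :* y₀ :+
      (r₀ :* (x₁ :* y₂ :+ x₂ :* y₁) :+ r₁ :* (x₂ :* y₀ :+ x₀ :* y₂) :+ r₂ :* (x₀ :* y₁ :+ x₁ :* y₀)) :* z₀ :=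
      (x₀ :* (y₁ :* z₂ :+ y₂ :* z₁) :+ x₁ :* (y₂ :* z₀ :+ y₀ :* z₂) :+ x₂ :* (y₀ :* z₁ :+ y₁ :* z₀)) :* r₀) refl

  dot-lin₂ : ∀ a X b Y N → dot (lin₂ a X b Y) N ≡ a * dot X N + b * dot Y N
  dot-lin₂ a X b Y N = trans (dot-⊕ (a · X) (b · Y) N) (cong₂ _+_ (dot-· a X N) (dot-· b Y N))

  dot-lin₃ : ∀ a X b Y c Z N → dot (lin₃ a X b Y c Z) N ≡ a * dot X N + b * dot Y N + c * dot Z N
  dot-lin₃ a X b Y c Z N = trans (dot-⊕ (lin₂ a X b Y) (c · Z) N) (cong₂ _+_ (dot-lin₂ a X b Y N) (dot-· c Z N))

  orthogonal-to-all : ∀ N → (∀ R → dot R N ≡ 0#) → N ≡ zeroV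
  orthogonal-to-all (n₀ ∷ n₁ ∷ n₂ ∷ []) ⊥N = cong₂ _∷_
    (trans (solve 3 (λ x y z → x := con true :* x :+ con false :* y :+ con false :* z) refl n₀ n₁ n₂)
        (⊥N (1# ∷ 0# ∷ 0# ∷ [])))
    (cong₂ _∷_ (trans (solve 3 (λ x y z → y := con false :* x :+ con true :* y :+ con false :* z) refl n₀ n₁ n₂)
        (⊥N (0# ∷ 1# ∷ 0# ∷ [])))
    (cong (_∷ []) (trans (solve 3 (λ x y z → z := con false :* x :+ con false :* y :+ con true :* z) refl n₀ n₁
        n₂) (⊥N (0# ∷ 0# ∷ 1# ∷ [])))))

  -- A vanishing product says y_k · X + x_k · Y = 0 for each index k; independence makes every x_k
  -- zero, against X ≠ 0.
  indep₂⇒cross≢0 : ∀ {X Y} → Indep₂ X Y → cross X Y ≢ zeroV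
  indep₂⇒cross≢0 {x₀ ∷ x₁ ∷ x₂ ∷ []} {y₀ ∷ y₁ ∷ y₂ ∷ []} i e = indep₂⇒≢0 i
    (cong₂ _∷_ (vanish y₀ x₀ (xy+yx≡0 y₀ x₀) (trans (swap y₀ x₁ x₀ y₁) c₂) (trans (swap′ y₀ x₂ x₀ y₂) c₁))
    (cong₂ _∷_ (vanish y₁ x₁ (trans (swap′ y₁ x₀ x₁ y₀) c₂) (xy+yx≡0 y₁ x₁) (trans (swap y₁ x₂ x₁ y₂) c₀))
    (cong (_∷ []) (vanish y₂ x₂ (trans (swap y₂ x₀ x₂ y₀) c₁) (trans (swap′ y₂ x₁ x₂ y₁) c₀) (xy+yx≡0 y₂ x₂)))))
    where
    c₀ = Vec.∷-injectiveˡ e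
    c₁ = Vec.∷-injectiveˡ (Vec.∷-injectiveʳ e)
    c₂ = Vec.∷-injectiveˡ (Vec.∷-injectiveʳ (Vec.∷-injectiveʳ e))
    swap : ∀ a b c d → a * b + c * d ≡ c * d + b * a
    swap = solve 4 (λ a b c d → a :* b :+ c :* d := c :* d :+ b :* a) refl
    swap′ : ∀ a b c d → a * b + c * d ≡ b * a + c * d
    swap′ = solve 4 (λ a b c d → a :* b :+ c :* d := b :* a :+ c :* d) refl
    vanish : ∀ a b → a * x₀ + b * y₀ ≡ 0# → a * x₁ + b * y₁ ≡ 0# → a * x₂ + b * y₂ ≡ 0# → b ≡ 0#
    vanish a b e₀ e₁ e₂ = proj₂ (i a b (cong₂ _∷_ e₀ (cong₂ _∷_ e₁ (cong (_∷ []) e₂))))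

  -- If the determinant vanished, `cramer` would be a linear relation for every R; its first
  -- coefficient being 0, the product of Y and Z would be orthogonal to everything.
  indep₃⇒det≢0 : ∀ {X Y Z} → Indep₃ X Y Z → dot X (cross Y Z) ≢ 0#
  indep₃⇒det≢0 {X} {Y} {Z} i det≡0 = indep₂⇒cross≢0 (indep₃⇒indep₂ (indep₃-swap₂₃ (indep₃-swap₁₂ i)))
    (orthogonal-to-all (cross Y Z) (λ R →
        proj₁ (i _ _ _ (trans (cramer X Y Z R) (trans (cong (_· R) det≡0) (·-zeroˡ R))))))

  module Frame {Q P₁ P₂ : F³} (frame : Indep₃ Q P₁ P₂) where

    -- Coordinates with respect to Q, P₁, P₂, multiplied by Δ = det(Q, P₁, P₂).
    U A B : F³ → Carrier
    U R = dot R (cross P₁ P₂)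
    A R = dot R (cross Q P₂)
    B R = dot R (cross Q P₁)

    Δ : Carrier
    Δ = U Q

    Δ≢0 : Δ ≢ 0#
    Δ≢0 = indep₃⇒det≢0 frame

    AP₁≡Δ : A P₁ ≡ Δ
    AP₁≡Δ = dot-cross-swap P₁ Q P₂

    BP₂≡Δ : B P₂ ≡ Δ
    BP₂≡Δ = trans (dot-cross-swap P₂ Q P₁) (cong (dot Q) (cross-comm P₂ P₁))

    module Rescaling (β ƛ : Carrier) (ƛ≢0 : ƛ ≢ 0#) where

      -- Here P₁ becomes (0, Δ, 0), P₂ becomes (0, 0, ƛ Δ), and Q becomes (Δ, β Δ, 0). At P₁, and at
      -- Q once β ≠ 0, the equation κ b = a² fails because b = 0 and a ≠ 0; at P₂ it fails because a
      -- = 0 and κ b ≠ 0.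
      to : F³ → F³
      to R = U R ∷ A R + β * U R ∷ ƛ * B R ∷ []

      linearIso : LinearIso
      linearIso = record
        { to      = to
        ; ⊕-homo  = λ X Y → cong₂ _∷_ (dot-⊕ X Y _) (cong₂ _∷_
            (trans (cong₂ (λ p q → p + β * q) (dot-⊕ X Y _) (dot-⊕ X Y _))
              (solve 5 (λ β p q r s → (p :+ q) :+ β :* (r :+ s) := (p :+ β :* r) :+ (q :+ β :* s)) refl β _ _ _ _))
            (cong (_∷ []) (trans (cong (ƛ *_) (dot-⊕ X Y _)) (distribˡ ƛ _ _))))
        ; ·-homo  = λ k X → cong₂ _∷_ (dot-· k X _) (cong₂ _∷_
            (trans (cong₂ (λ p q → p + β * q) (dot-· k X _) (dot-· k X _))
              (solve 4 (λ β k p q → k :* p :+ β :* (k :* q) := k :* (p :+ β :* q)) refl β k _ _))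
            (cong (_∷ []) (trans (cong (ƛ *_) (dot-· k X _))
                (solve 3 (λ l k p → l :* (k :* p) := k :* (l :* p)) refl ƛ k _))))
        ; kernel  = kernel
        ; onto    = onto
        }
        where
        open ≡-Reasoning
        kernel : ∀ {X} → to X ≡ zeroV → X ≡ zeroV
        kernel {X} e = trans (·-cancel-inv Δ≢0 ΔX≡0) (·-zeroʳ 3 (inv Δ))
          where
          u≡0 : U X ≡ 0#
          u≡0 = Vec.∷-injectiveˡ e
          a≡0 : A X ≡ 0#
          a≡0 = trans (solve 2 (λ a β → a := a :+ β :* con false) refl (A X) β)
            (trans (cong (λ k → A X + β * k) (sym u≡0)) (Vec.∷-injectiveˡ (Vec.∷-injectiveʳ e)))
          b≡0 : B X ≡ 0#
          b≡0 = *-cancel-0 ƛ≢0 (Vec.∷-injectiveˡ (Vec.∷-injectiveʳ (Vec.∷-injectiveʳ e)))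
          ΔX≡0 : Δ · X ≡ zeroV
          ΔX≡0 = begin
            Δ · X                                  ≡⟨ cramer Q P₁ P₂ X ⟨
            lin₃ (U X) Q (A X) P₁ (B X) P₂
              ≡⟨ cong₂ _⊕_ (cong₂ (λ k l → lin₂ k Q l P₁) u≡0 a≡0) (cong (_· P₂) b≡0) ⟩
            lin₃ 0# Q 0# P₁ 0# P₂                  ≡⟨ trans (lin₂-dropʳ P₂) (trans (lin₂-dropʳ P₁) (·-zeroˡ Q)) ⟩
            zeroV                                  ∎

        onto : ∀ Y → ∃[ X ] to X ≡ Y
        onto (x ∷ y ∷ z ∷ []) = lin₃ α Q γ P₁ δ P₂ , cong₂ _∷_ u≡ (cong₂ _∷_ a+βu≡ (cong (_∷ []) ƛb≡))
          where
          i = inv Δ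
          α = i * x
          γ = i * (y + β * x)
          δ = i * (inv ƛ * z)
          iΔ : ∀ w → i * w * Δ ≡ w
          iΔ w = begin
            i * w * Δ     ≡⟨ solve 3 (λ i w d → i :* w :* d := (d :* i) :* w) refl i w Δ ⟩
            (Δ * i) * w   ≡⟨ cong (_* w) (*-invʳ Δ≢0) ⟩
            1# * w        ≡⟨ *-identityˡ w ⟩
            w             ∎
          u≡ : U (lin₃ α Q γ P₁ δ P₂) ≡ x
          u≡ = begin
            U (lin₃ α Q γ P₁ δ P₂)               ≡⟨ dot-lin₃ α Q γ P₁ δ P₂ _ ⟩
            α * Δ + γ * U P₁ + δ * U P₂
              ≡⟨ cong₂ (λ k l → α * Δ + γ * k + δ * l) (dot-crossˡ P₁ P₂) (dot-crossʳ P₁ P₂) ⟩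
            α * Δ + γ * 0# + δ * 0#
              ≡⟨ solve 3 (λ w g d → w :+ g :* con false :+ d :* con false := w) refl (α * Δ) γ δ ⟩
            α * Δ                                ≡⟨ iΔ x ⟩
            x                                    ∎
          a≡ : A (lin₃ α Q γ P₁ δ P₂) ≡ y + β * x
          a≡ = begin
            A (lin₃ α Q γ P₁ δ P₂)               ≡⟨ dot-lin₃ α Q γ P₁ δ P₂ _ ⟩
            α * A Q + γ * A P₁ + δ * A P₂
              ≡⟨ cong₂ _+_ (cong₂ (λ k l → α * k + γ * l) (dot-crossˡ Q P₂) AP₁≡Δ) (cong (δ *_) (dot-crossʳ Q P₂)) ⟩
            α * 0# + γ * Δ + δ * 0#
              ≡⟨ solve 3 (λ w g d → g :* con false :+ w :+ d :* con false := w) refl (γ * Δ) α δ ⟩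
            γ * Δ                                ≡⟨ iΔ (y + β * x) ⟩
            y + β * x                            ∎
          b≡ : B (lin₃ α Q γ P₁ δ P₂) ≡ inv ƛ * z
          b≡ = begin
            B (lin₃ α Q γ P₁ δ P₂)               ≡⟨ dot-lin₃ α Q γ P₁ δ P₂ _ ⟩
            α * B Q + γ * B P₁ + δ * B P₂
              ≡⟨ cong₂ _+_ (cong₂ (λ k l → α * k + γ * l) (dot-crossˡ Q P₁) (dot-crossʳ Q P₁)) (cong (δ *_) BP₂≡Δ) ⟩
            α * 0# + γ * 0# + δ * Δ
              ≡⟨ solve 3 (λ w g d → g :* con false :+ d :* con false :+ w := w) refl (δ * Δ) α γ ⟩
            δ * Δ                                ≡⟨ iΔ (inv ƛ * z) ⟩
            inv ƛ * z                            ∎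
          a+βu≡ : A (lin₃ α Q γ P₁ δ P₂) + β * U (lin₃ α Q γ P₁ δ P₂) ≡ y
          a+βu≡ = trans (cong₂ (λ p q → p + β * q) a≡ u≡)
              (solve 3 (λ y b x → (y :+ b :* x) :+ b :* x := y) refl y β x)
          ƛb≡ : ƛ * B (lin₃ α Q γ P₁ δ P₂) ≡ z
          ƛb≡ = begin
            ƛ * B (lin₃ α Q γ P₁ δ P₂)   ≡⟨ cong (ƛ *_) b≡ ⟩
            ƛ * (inv ƛ * z)              ≡⟨ *-assoc ƛ (inv ƛ) z ⟨
            (ƛ * inv ƛ) * z              ≡⟨ cong (_* z) (*-invʳ ƛ≢0) ⟩
            1# * z                       ≡⟨ *-identityˡ z ⟩
            z                            ∎

  -- Two points of the arc whose secant misses the sum-point.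

  record FramePoints (K : List F³) (Q : F³) : Set where
    field
      P₁ P₂        : F³
      rest         : List F³
      frame        : Indep₃ Q P₁ P₂
      P₁∈K         : P₁ ∈ K
      P₂∈K         : P₂ ∈ K
      classify     : ∀ {R} → R ∈ K → R ≡ P₁ ⊎ R ≡ P₂ ⊎ R ∈ rest
      rest≢P₁      : ∀ {R} → R ∈ rest → R ≢ P₁
      rest≢P₂      : ∀ {R} → R ∈ rest → R ≢ P₂
      length-rest  : length K ≡ 2 ℕ.+ length rest
      rest-inhabited : 0 ℕ.< length rest

  -- Two points cover only a line, whose normal vector `cross A B` would annihilate the plane; so K
  -- has a third point C. If Q lay on both AB and AC, subtracting the two expressions and using
  -- independence of A, B, C would make Q a multiple of A.
  framePoints : ∀ {K Q Y Z} → Unique K → ProjectiveCap K → Covers K → (∀ {P} → P ∈ K → Indep₂ Q P) →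
    Y ∈ K → Z ∈ K → Y ≢ Z → FramePoints K Q
  framePoints {A ∷ []} _ _ _ _ (here refl) (here refl) Y≢Z = contradiction refl Y≢Z
  framePoints {A ∷ B ∷ []} ((A≢B ∷ []) ∷ _) cap covers _ _ _ _ =
    contradiction (orthogonal-to-all (cross A B) orthogonal)
        (indep₂⇒cross≢0 (indep₂ (here refl) (there (here refl)) A≢B))
    where
    open ProjectiveCap cap
    orthogonal-member : ∀ {R} → R ∈ A ∷ B ∷ [] → dot R (cross A B) ≡ 0#
    orthogonal-member (here refl)          = dot-crossˡ A B
    orthogonal-member (there (here refl))  = dot-crossʳ A B
    orthogonal : ∀ R → dot R (cross A B) ≡ 0#
    orthogonal R with covers R
    ... | Y , Z , Y∈ , Z∈ , α , β , refl = begin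
      dot (lin₂ α Y β Z) (cross A B)                        ≡⟨ dot-lin₂ α Y β Z (cross A B) ⟩
      α * dot Y (cross A B) + β * dot Z (cross A B)
        ≡⟨ cong₂ (λ p q → α * p + β * q) (orthogonal-member Y∈) (orthogonal-member Z∈) ⟩
      α * 0# + β * 0#
        ≡⟨ solve 2 (λ a b → a :* con false :+ b :* con false := con false) refl α β ⟩
      0#                                                    ∎
      where open ≡-Reasoning
  framePoints {A ∷ B ∷ C ∷ r} {Q} ((A≢B ∷ A≢C ∷ A∉r) ∷ (B≢C ∷ B∉r) ∷ C∉r ∷ _) cap covers Q-indep _ _ _ with
      onSecant? {2} Q A B
  ... | no ¬on = record
    { P₁ = A ; P₂ = B ; rest = C ∷ r
    ; frame = off-secant⇒indep₃ (indep₂ (here refl) (there (here refl)) A≢B) ¬on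
    ; P₁∈K = here refl
    ; P₂∈K = there (here refl)
    ; classify = λ { (here e) → inj₁ e ; (there (here e)) → inj₂ (inj₁ e) ; (there (there R∈)) → inj₂ (inj₂ R∈) }
    ; rest≢P₁ = λ R∈ e → All.lookup (A≢C ∷ A∉r) R∈ (sym e)
    ; rest≢P₂ = λ R∈ e → All.lookup (B≢C ∷ B∉r) R∈ (sym e)
    ; length-rest = refl
    ; rest-inhabited = ℕ.s≤s ℕ.z≤n
    }
    where open ProjectiveCap cap
  ... | yes (c₁ , c₂ , e) = record
    { P₁ = A ; P₂ = C ; rest = B ∷ r
    ; frame = off-secant⇒indep₃ (indep₂ (here refl) (there (there (here refl))) A≢C) not-both
    ; P₁∈K = here refl
    ; P₂∈K = there (there (here refl))
    ; classify = λ { (here e) → inj₁ e ; (there (here e)) → inj₂ (inj₂ (here e))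
                   ; (there (there (here e))) → inj₂ (inj₁ e)
                   ; (there (there (there R∈))) → inj₂ (inj₂ (there R∈)) }
    ; rest≢P₁ = λ R∈ e → All.lookup (A≢B ∷ A∉r) R∈ (sym e)
    ; rest≢P₂ = λ { (here refl) e → B≢C e ; (there R∈) e → All.lookup C∉r R∈ (sym e) }
    ; length-rest = refl
    ; rest-inhabited = ℕ.s≤s ℕ.z≤n
    }
    where
    open ProjectiveCap cap
    regroup : ∀ {n} c₁ c₂ d₁ d₂ (A B C : Vec Carrier n) → lin₃ (c₁ + d₁) A c₂ B d₂ C ≡ lin₂ c₁ A c₂ B ⊕ lin₂ d₁ A d₂ C
    regroup c₁ c₂ d₁ d₂ [] [] [] = refl
    regroup c₁ c₂ d₁ d₂ (x ∷ A) (y ∷ B) (z ∷ C) = cong₂ _∷_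
      (solve 7 (λ c₁ c₂ d₁ d₂ x y z →
          (c₁ :+ d₁) :* x :+ c₂ :* y :+ d₂ :* z := (c₁ :* x :+ c₂ :* y) :+ (d₁ :* x :+ d₂ :* z)) refl c₁ c₂ d₁
              d₂ x y z)
      (regroup c₁ c₂ d₁ d₂ A B C)
    not-both : ¬ OnSecant {2} Q A C
    not-both (d₁ , d₂ , e′)
      with indep₃ (here refl) (there (here refl)) (there (there (here refl))) A≢B A≢C B≢C (c₁ + d₁) c₂ d₂
             (trans (regroup c₁ c₂ d₁ d₂ A B C) (X≡Y⇒X⊕Y≡0 (trans (sym e) e′)))
    ... | _ , refl , _ = 0≢1 (sym (proj₁ (Q-indep (here refl) 1# c₁
            (X≡Y⇒X⊕Y≡0 (trans (·-identity Q) (trans e (lin₂-dropʳ B)))))))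

  -- Counting the coefficients of the secants through the sum-point.

  ∈-pairs : ∀ {A : Set} {x y : A} {xs} → x ∈ xs → y ∈ xs → x ≢ y → (x , y) ∈ pairs xs ⊎ (y , x) ∈ pairs xs
  ∈-pairs (here refl) (here refl) x≢y = contradiction refl x≢y
  ∈-pairs (here refl) (there y∈)  _   = inj₁ (∈-++⁺ˡ (∈-map⁺ (_ ,_) y∈))
  ∈-pairs (there x∈)  (here refl) _   = inj₂ (∈-++⁺ˡ (∈-map⁺ (_ ,_) x∈))
  ∈-pairs {xs = z ∷ zs} (there x∈) (there y∈) x≢y with ∈-pairs x∈ y∈ x≢y
  ... | inj₁ p = inj₁ (∈-++⁺ʳ (map (z ,_) zs) p)
  ... | inj₂ p = inj₂ (∈-++⁺ʳ (map (z ,_) zs) p)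

  module _ (K : List F³) (Q : F³) where
    private
      on? : ∀ p → Dec (OnSecant {2} Q (proj₁ p) (proj₂ p))
      on? p = onSecant? Q (proj₁ p) (proj₂ p)

      coefficient : F³ × F³ → Carrier
      coefficient p with on? p
      ... | yes (c , _)  = c
      ... | no _         = 0#

    secantCoefficients : List Carrier
    secantCoefficients = map coefficient (filter on? (pairs K))

    length-secantCoefficients : length secantCoefficients ≡ secantCount K Q
    length-secantCoefficients = trans (length-map coefficient (filter on? (pairs K)))
      (cong length (filter-≐ on? _ ((λ p → p) , (λ p → p)) (pairs K)))

    -- Independence of the two points makes the coefficients found by `onSecant?` the only possible
    -- ones. `pairs` holds just one order of each pair, which is harmless since both coefficients
    -- are c.
    ∈-secantCoefficients : ProjectiveCap K → ∀ {c} → SecantCoefficient K Q c → c ∈ secantCoefficients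
    ∈-secantCoefficients cap {c} (P₁ , P₂ , P₁∈K , P₂∈K , P₁≢P₂ , e) = either (∈-pairs P₁∈K P₂∈K P₁≢P₂)
      where
      member : ∀ {P₁ P₂} → (P₁ , P₂) ∈ pairs K → Indep₂ P₁ P₂ → Q ≡ lin₂ c P₁ c P₂ → c ∈ secantCoefficients
      member {P₁} {P₂} p i e = subst (_∈ secantCoefficients) coefficient≡c
          (∈-map⁺ coefficient (∈-filter⁺ on? p (c , c , e)))
        where
        coefficient≡c : coefficient (P₁ , P₂) ≡ c
        coefficient≡c with on? (P₁ , P₂)
        ... | yes (c₁ , c₂ , e′) = proj₁ (indep₂-coefficients i (trans (sym e′) e))
        ... | no ¬on = contradiction (c , c , e) ¬on

      independent : Indep₂ P₁ P₂
      independent = ProjectiveCap.indep₂ cap P₁∈K P₂∈K P₁≢P₂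

      either : (P₁ , P₂) ∈ pairs K ⊎ (P₂ , P₁) ∈ pairs K → c ∈ secantCoefficients
      either (inj₁ p) = member p independent e
      either (inj₂ p) = member p (indep₂-swap independent) (trans e (⊕-comm _ _))

  -- Choosing coordinates in which the planar cap avoids its bad points.

  square≡0 : ∀ {x} → x * x ≡ 0# → x ≡ 0#
  square≡0 e = square-injective (trans e (sym (zeroˡ 0#)))

  *-solve : ∀ {x y d} → d ≢ 0# → x * d ≡ y → x ≡ y * inv d
  *-solve {x} {d = d} d≢0 refl = sym (trans (*-assoc x d (inv d)) (trans (cong (x *_) (*-invʳ d≢0)) (*-identityʳ x)))

  module _ {K : List F³} {Q : F³} (S : SumPointCap K Q) (fp : FramePoints K Q) where
    open SumPointCap S
    open ProjectiveCap cap
    open FramePoints fp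
    open Frame frame

    private
      Γ = secantCoefficients K Q

      -- With these choices κ b = a² and κ = c u have no common solution at Q and at the points of rest.
      β-excluded : List Carrier
      β-excluded = 0# ∷ map (λ R → A R * inv (U R)) rest

      -- The one scale at which R satisfies κ b = a² with κ = c · U R. For B R = 0 the formula is a
      -- dummy value; `β` takes care of that case.
      ƛ-bad : Carrier → F³ → Carrier → Carrier
      ƛ-bad β R c = (A R + β * U R) * (A R + β * U R) * inv (c * U R * B R)

      ƛ-excluded : Carrier → List Carrier
      ƛ-excluded β = 0# ∷ cartesianProductWith (ƛ-bad β) rest Γ

    -- Beyond the frame, R has U R ≠ 0 by independence from P₁ and P₂, so badness means κ = c · U R.
    -- If B R = 0 it would force A R = β · U R, an excluded β; otherwise it determines ƛ as an
    -- excluded value.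
    seed : ∀ {β ƛ} → β ∉ β-excluded → ƛ ∉ ƛ-excluded β → ∃[ K′ ] ∃[ Q′ ] (Seed K′ Q′ × length K′ ≡ length K)
    seed {β} {ƛ} β∉ ƛ∉ = map to K , to Q ,
        record { sumPointCap = transfer S ; avoids = avoids ; Q-avoids = Q-avoids } , length-map to K
      where
      ƛ≢0 : ƛ ≢ 0#
      ƛ≢0 refl = ƛ∉ (here refl)

      open Rescaling β ƛ ƛ≢0
      open Transfer linearIso
      open ≡-Reasoning

      on-line : ∀ {κ R} → κ * (ƛ * B R) ≡ (A R + β * U R) * (A R + β * U R) → B R ≡ 0# → A R + β * U R ≡ 0#
      on-line {κ} {R} e b≡0 = square≡0 (begin
        (A R + β * U R) * (A R + β * U R)   ≡⟨ e ⟨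
        κ * (ƛ * B R)                       ≡⟨ cong (λ k → κ * (ƛ * k)) b≡0 ⟩
        κ * (ƛ * 0#)                        ≡⟨ solve 2 (λ k l → k :* (l :* con false) := con false) refl κ ƛ ⟩
        0#                                  ∎)

      Q-avoids : ¬ Bad (map to K) (to Q) 1 (to Q)
      Q-avoids (κ , κ≢0 , (e , _) , _) with integral (begin
        β * U Q          ≡⟨ +-identityˡ _ ⟨
        0# + β * U Q     ≡⟨ cong (_+ β * U Q) (dot-crossˡ Q P₂) ⟨
        A Q + β * U Q    ≡⟨ on-line {κ} {Q} e (dot-crossˡ Q P₁) ⟩
        0#               ∎)
      ... | inj₁ β≡0 = β∉ (here β≡0)
      ... | inj₂ Δ≡0 = Δ≢0 Δ≡0

      avoids-member : ∀ {R} → R ∈ K → ¬ Bad (map to K) (to Q) 1 (to R)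
      avoids-member R∈K (κ , κ≢0 , (e , _) , side) with classify R∈K
      ... | inj₁ refl = Δ≢0 (begin
        Δ                  ≡⟨ AP₁≡Δ ⟨
        A P₁               ≡⟨ solve 2 (λ a b → a := a :+ b :* con false) refl (A P₁) β ⟩
        A P₁ + β * 0#      ≡⟨ cong (λ k → A P₁ + β * k) (dot-crossˡ P₁ P₂) ⟨
        A P₁ + β * U P₁    ≡⟨ on-line {κ} {P₁} e (dot-crossʳ Q P₁) ⟩
        0#                 ∎)
      ... | inj₂ (inj₁ refl) = Δ≢0 (trans (sym BP₂≡Δ) (*-cancel-0 ƛ≢0 (*-cancel-0 κ≢0 (begin
        κ * (ƛ * B P₂)                              ≡⟨ e ⟩
        (A P₂ + β * U P₂) * (A P₂ + β * U P₂)
          ≡⟨ cong (λ k → k * k) (cong₂ (λ p q → p + β * q) (dot-crossʳ Q P₂) (dot-crossʳ P₁ P₂)) ⟩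
        (0# + β * 0#) * (0# + β * 0#)
          ≡⟨ solve 1 (λ b → (con false :+ b :* con false) :* (con false :+ b :* con false) := con false) refl β ⟩
        0#                                          ∎))))
      avoids-member {R} R∈K (κ , κ≢0 , (e , _) , side) | inj₂ (inj₂ R∈rest) = off-frame side
        where
        u≢0 : U R ≢ 0#
        u≢0 = indep₃⇒det≢0 (indep₃ R∈K P₁∈K P₂∈K (rest≢P₁ R∈rest) (rest≢P₂ R∈rest)
          (λ P₁≡P₂ → indep₂⇒cross≢0 (indep₃⇒indep₂ (indep₃-swap₂₃ (indep₃-swap₁₂ frame)))
            (trans (cong (cross P₁) (sym P₁≡P₂)) (cross-self P₁))))

        off-frame : ¬ (U R ≡ 0# ⊎ ∃[ c ] (SecantCoefficient (map to K) (to Q) c × κ ≡ c * U R))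
        off-frame (inj₁ u≡0) = u≢0 u≡0
        off-frame (inj₂ (c , sc , refl)) with B R ≟ 0#
        ... | yes b≡0 = β∉ (there (subst (_∈ map (λ R → A R * inv (U R)) rest)
          (sym (*-solve u≢0 (sym (x+y≡0⇒x≡y (on-line {c * U R} {R} e b≡0))))) (∈-map⁺ _ R∈rest)))
        ... | no b≢0 = ƛ∉ (there (subst (_∈ cartesianProductWith (ƛ-bad β) rest Γ)
          (sym (*-solve (*-≢0 κ≢0 b≢0) (trans
              (solve 3 (λ l k b → l :* (k :* b) := k :* (l :* b)) refl ƛ (c * U R) (B R)) e)))
          (∈-cartesianProductWith⁺ (ƛ-bad β) R∈rest (∈-secantCoefficients K Q cap (secantCoefficient⁻ sc)))))

      avoids : ∀ {P} → P ∈ map to K → ¬ Bad (map to K) (to Q) 1 P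
      avoids P∈ with ∈-map⁻ to P∈
      ... | R , R∈K , refl = avoids-member R∈K

    -- Here `rest` has k - 2 points, so `β` must avoid 1 + (k - 2) values and `ƛ` must avoid 1 + (k
    -- - 2) p(K). The second count is where (k - 2) p(K) < q - 1 comes from; as p(K) ≥ 1, it
    -- dominates the first.
    ∃-seed : 0 ℕ.< secantCount K Q → suc (length rest ℕ.* secantCount K Q) ℕ.< order →
      ∃[ K′ ] ∃[ Q′ ] (Seed K′ Q′ × length K′ ≡ length K)
    ∃-seed 0<p small with ∃-fresh _≟_ {ys = β-excluded} distinct β-bound
      where
      instance p≢0 : ℕ.NonZero (secantCount K Q)
               p≢0 = ℕ.>-nonZero 0<p
      β-bound : length β-excluded ℕ.< order
      β-bound = ℕ.≤-<-trans (ℕ.s≤s (ℕ.≤-trans (ℕ.≤-reflexive (length-map _ rest))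
          (ℕ.m≤m*n (length rest) (secantCount K Q)))) small
    ... | β , _ , β∉ with ∃-fresh _≟_ {ys = ƛ-excluded β} distinct ƛ-bound
      where
      ƛ-bound : length (ƛ-excluded β) ℕ.< order
      ƛ-bound = ℕ.≤-<-trans (ℕ.s≤s (ℕ.≤-reflexive (trans (length-cartesianProductWith (ƛ-bad β) rest Γ)
        (cong (length rest ℕ.*_) (length-secantCoefficients K Q))))) small
    ... | ƛ , _ , ƛ∉ = seed β∉ ƛ∉

-- Assembly for a field of order 2^h.

module _ (F : FiniteField) where
  open FiniteField F using (order)
  open Geometry F
  open FieldProperties F using (order≡2^h⇒1+1≡0)

  blow-up-completeCap : ∀ h → order ≡ 2 ℕ.^ h → ∀ j (K : List (Vector 2)) (Q : Vector 2) →
    CompleteCap K → UniqueSumPoint K Q → (length K ℕ.∸ 2) ℕ.* secantCount K Q ℕ.< order ℕ.∸ 1 →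
    ∃[ C ] (CompleteCap {double (suc j)} C × length C ℕ.≤ length K ℕ.* geomSum order j)
  blow-up-completeCap h order≡2^h j K Q K-complete Q-unique@((nQ , Q∉K , sum) , _) small
    with Characteristic2.secant-through F (order≡2^h⇒1+1≡0 h order≡2^h) K-complete nQ Q∉K
  ... | Y , Z , Y∈K , Z∈K , Y≢Z , c , c′ , e with sum Y∈K Z∈K Y≢Z c c′ e
  ... | refl = build (∃-seed sumPointCap fp 0<p small′)
    where
    1+1≡0 = order≡2^h⇒1+1≡0 h order≡2^h
    open Characteristic2 F 1+1≡0

    cap : ProjectiveCap K
    cap = cap⇒projectiveCap (proj₁ K-complete)

    normalized = All.lookup (proj₁ (proj₂ (proj₁ K-complete)))

    fp : FramePoints K Q
    fp = framePoints (proj₁ (proj₁ K-complete)) cap (completeCap-covers K-complete Y∈K)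
      (λ P∈K → normalized-indep₂ nQ (normalized P∈K) (λ { refl → Q∉K P∈K })) Y∈K Z∈K Y≢Z
    open FramePoints fp

    -- Completeness puts Q on a secant, and the coefficient of that secant inhabits the list of
    -- length p(K).
    0<p : 0 ℕ.< secantCount K Q
    0<p = subst (0 ℕ.<_) (length-secantCoefficients K Q)
      (∈-length (∈-secantCoefficients K Q cap (Y , Z , Y∈K , Z∈K , Y≢Z , e)))

    small′ : suc (length rest ℕ.* secantCount K Q) ℕ.< order
    small′ = subst (λ n → suc (n ℕ.* secantCount K Q) ℕ.< order) (cong (ℕ._∸ 2) length-rest) (<pred⇒suc< order small)
      where
      <pred⇒suc< : ∀ {m} n → m ℕ.< n ℕ.∸ 1 → suc m ℕ.< n
      <pred⇒suc< (suc n) m<n = ℕ.s≤s m<n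

    sumPointCap : SumPointCap K Q
    -- More than two field elements: `rest` and p(K) are both at least 1, so 2 ≤ 1 + (k - 2) p(K) <
    -- q.
    sumPointCap = completeCap⇒sumPointCap (ℕ.≤-<-trans (ℕ.s≤s (ℕ.*-mono-≤ rest-inhabited 0<p)) small′)
        K-complete Q-unique

    build : ∃[ K′ ] ∃[ Q′ ] (Seed K′ Q′ × length K′ ≡ length K) →
      ∃[ C ] (CompleteCap {double (suc j)} C × length C ℕ.≤ length K ℕ.* geomSum order j)
    build (K′ , Q′ , S , length≡) =
        subst (λ k → ∃[ C ] (CompleteCap {double (suc j)} C × length C ℕ.≤ k ℕ.* geomSum order j))
      length≡ (Step.tower-completeCap S j)

open import Data.Nat using (_*_; _^_; _∸_; _<_; _≤_)

theorem3p17 : (F : FiniteField) (h : ℕ) → FiniteField.order F ≡ 2 ^ h →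
    (N m : ℕ) → N ≡ 2 * m → 2 < N →
    (K : List (Geometry.Vector F 2)) (Q : Geometry.Vector F 2) →
    Geometry.CompleteCap F K → Geometry.UniqueSumPoint F K Q →
    (length K ∸ 2) * Geometry.secantCount F K Q < FiniteField.order F ∸ 1 →
    ∃[ C ] (Geometry.CompleteCap F {N} C ×
    length C ≤ length K * geomSum (FiniteField.order F) (m ∸ 1))
theorem3p17 F h order≡2^h N (suc j) N≡2m 2<N K Q K-complete Q-unique small with trans N≡2m (sym (double≡2* (suc j)))
... | refl = blow-up-completeCap F h order≡2^h j K Q K-complete Q-unique small
theorem3p17 F h order≡2^h N zero refl () K Q
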